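{- Let $n>3$ be an odd integer and let $\varepsilon\in\{ -1,1\}$. Then there exists an edge-regular Deza graph with parameters $$ \left( \frac{5^{n-1} + \varepsilon 5^{\frac{n-1}{2}}}{2},\; 5^{n-2} - \varepsilon 5^{\frac{n-3}{2}},\; 2\bigl(5^{n-3} - \varepsilon 5^{\frac{n-3}{2}}\bigr),\; 2 \cdot 5^{n-3} - \varepsilon 5^{\frac{n-3}{2}} \right) $$ whose two children are strongly regular graphs: the child in which two distinct vertices are adjacent iff they have $2(5^{n-3} - \varepsilon 5^{\frac{n-3}{2}})$ common neighbours is strongly regular with parameters $$ \left( \frac{5^{n-1} + \varepsilon 5^{\frac{n-1}{2}}}{2},\; \frac{5^{n-2} - \varepsilon 5^{\frac{n-3}{2}}}{2},\; \frac{5^{n-3} + \varepsilon 5^{\frac{n-3}{2}}}{2},\; \frac{5^{n-3} - \varepsilon 5^{\frac{n-3}{2}}}{2} \right), $$ and the child in which two distinct vertices are adjacent iff they have $2 \cdot 5^{n-3} - \varepsilon 5^{\frac{n-3}{2}}$ common neighbours is strongly regular with parameters $$ \left( \frac{5^{n-1} + \varepsilon 5^{\frac{n-1}{2}}}{2},\; 2\cdot 5^{n-2} + 3\varepsilon 5^{\frac{n-3}{2}}-1,\; 8\cdot 5^{n-3} + 3\varepsilon 5^{\frac{n-3}{2}}-2,\; 8\cdot 5^{n-3} + 4\varepsilon 5^{\frac{n-3}{2}} \right). $$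
   Context: Graphs are finite, simple and undirected; $\Gamma(v)$ denotes the set of neighbours of $v$. A graph is a Deza graph with parameters $(N,k,b,a)$ if it has $N$ vertices, is $k$-regular, and $|\Gamma(u)\cap\Gamma(v)|\in\{a,b\}$ for any two distinct vertices $u,v$ (no order between $a$ and $b$ is imposed here). If $a\neq b$, the children of a Deza graph are the two graphs on the same vertex set in which two distinct vertices are adjacent iff they have exactly $a$ (respectively exactly $b$) common neighbours. A regular graph is edge-regular if any two adjacent vertices have the same number of common neighbours. A graph is strongly regular with parameters $(N,k,\lambda,\mu)$ if it has $N$ vertices, is $k$-regular, any two adjacent vertices have exactly $\lambda$ common neighbours, and any two distinct non-adjacent vertices have exactly $\mu$ common neighbours. -}

module Defs where

open import Data.Fin.Base using (Fin)
open import Data.Fin.Properties using (_≟_)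
open import Data.Fin.Subset using (Subset; ∣_∣; _∩_)
open import Data.Integer.Base using (ℤ; +_)
import Data.Integer.Properties as ℤ
open import Data.Nat.Base using (ℕ)
open import Data.Product.Base using (_×_; _,_; ∃-syntax)
open import Data.Sum.Base using (_⊎_)
open import Data.Vec.Base using (tabulate)
open import Data.Fin.Subset.Properties using (∩-comm)
open import Level using (0ℓ)
open import Relation.Binary.Core using (Rel)
open import Relation.Binary.Definitions using (Decidable; Symmetric)
open import Relation.Binary.PropositionalEquality
  using (_≡_; _≢_; refl; sym; trans; cong)
open import Relation.Nullary.Decidable.Core using (does; _×-dec_; ¬?)
open import Relation.Nullary.Negation.Core using (¬_)

record Graph (n : ℕ) : Set₁ where
  field
    Adj       : Rel (Fin n) 0ℓ
    adj?      : Decidable Adj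
    symmetric : Symmetric Adj
    loopless  : ∀ v → ¬ Adj v v

  Γ : Fin n → Subset n
  Γ v = tabulate λ u → does (adj? v u)

  degree : Fin n → ℕ
  degree v = ∣ Γ v ∣

  commonNeighbours : Fin n → Fin n → ℕ
  commonNeighbours u v = ∣ Γ u ∩ Γ v ∣

open Graph

-- Parameters of graphs are integers, since the formulas giving them involve
-- signs and subtraction; each is compared with a natural-number count.

module _ {n : ℕ} (G : Graph n) where

  IsRegular : ℤ → Set
  IsRegular k = ∀ v → + degree G v ≡ k

  IsEdgeRegular : Set
  IsEdgeRegular =
    (∃[ k ] IsRegular k) ×
    (∃[ l ] (∀ u v → Adj G u v → + commonNeighbours G u v ≡ l))

  record IsDeza (N k b a : ℤ) : Set where
    field
      order   : + n ≡ N
      regular : IsRegular k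
      common  : ∀ u v → u ≢ v →
                + commonNeighbours G u v ≡ a ⊎ + commonNeighbours G u v ≡ b

  record IsStronglyRegular (N k l m : ℤ) : Set where
    field
      order       : + n ≡ N
      regular     : IsRegular k
      adjacent    : ∀ u v → Adj G u v → + commonNeighbours G u v ≡ l
      nonadjacent : ∀ u v → u ≢ v → ¬ Adj G u v → + commonNeighbours G u v ≡ m

  -- For a Deza graph with b ≢ a, its two children are child b and child a.
  child : ℤ → Graph n
  child c = record
    { Adj       = λ u v → u ≢ v × + commonNeighbours G u v ≡ c
    ; adj?      = λ u v → ¬? (u ≟ v) ×-dec (+ commonNeighbours G u v ℤ.≟ c)
    ; symmetric = λ {u} {v} (u≢v , p) →
        (λ v≡u → u≢v (sym v≡u)) ,
        trans (cong (λ s → + ∣ s ∣) (∩-comm (Γ G v) (Γ G u))) p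
    ; loopless  = λ v (v≢v , _) → v≢v refl
    }

module Submission where

-- The obstacle is that the counts grow with n, while only statements about 𝔽 itself can be settled
-- by evaluation. Hence every count is kept in the shape of a multiple of `A` plus `E` times a
-- function on 𝔽, with `A` and `E` abstract; they finally become 5^(n-3) and ε 5^((n-3)/2). All
-- steps are linear, so each splits into an identity between functions on 𝔽, checked case by case,
-- and ring arithmetic in `A` and `E`. The isotropic case cannot be avoided: with c = B y x one has
-- Q z = 1 - c², which vanishes for c = ±1, and then y need not be ±x. Since the counts turn out to
-- depend on z through Q z alone, Witt's theorem is not invoked. That only two numbers of common
-- neighbours occur rests on the final table: c = ±1 and c = ±2 give the same value, and only c = 0
-- differs.

-- On 𝔽₅ⁿ with the form d (x₁² + … + xₙ²), take as vertices the vectors with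
-- Q w = 1 up to sign, and join x and y when B x y = ±2. Orthogonality is one
-- child and its complement the other. Every parameter is a number of solutions
-- of Q w = 1, B w x = s, B w y = t. Replacing y by its component z orthogonal to
-- x, these follow from the value distribution of Q alone: if Q z ≠ 0, completing
-- the square along z reduces to t = 0, and the circulant relation between the
-- counts with t = 0 and those without any condition on B w z is invertible over
-- 𝔽₅; if Q z = 0, translation along z makes Q equidistributed on B w z = t ≠ 0.
-- The two signs ε are the quadratic characters of d = 1 and d = 2.

open import Defs
open import Data.Bool.Base using (Bool; true; false; _∧_)
open import Data.Bool.Properties as Bool using ()
open import Data.Empty using (⊥)
open import Data.Fin.Base as Fin using (Fin; toℕ)
open import Data.Fin.Patterns
open import Data.Fin.Permutation using (permutation)
open import Data.Fin.Properties using (_≟_; all?)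
open import Data.Fin.Subset using (∣_∣; _∩_)
open import Data.Integer.Base as ℤ using (ℤ; +_; _+_; _-_; -_; _*_; _^_; _/ℕ_; 0ℤ; 1ℤ; -1ℤ)
open import Data.Integer.Properties as ℤ using ()
open import Data.Integer.Tactic.RingSolver using (solve-∀)
open import Data.List.Base as List using (List; []; _∷_; _++_; length; lookup; filter; cartesianProductWith; allFin)
open import Data.List.Membership.Propositional.Properties using (∈-lookup)
open import Data.List.Relation.Unary.All as All using ([]; _∷_)
open import Data.List.Relation.Unary.All.Properties using (all-filter)
open import Data.List.Relation.Unary.AllPairs using ([]; _∷_)
open import Data.List.Relation.Unary.Unique.Propositional using (Unique)
open import Data.List.Relation.Unary.Unique.Propositional.Properties using (cartesianProductWith⁺; filter⁺; allFin⁺)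
open import Data.Nat.Base as ℕ using (ℕ; zero; suc; s≤s; _∸_; _<_; ⌊_/2⌋; parity)
open import Data.Nat.DivMod using (_mod_; m*n/n≡m)
open import Data.Parity.Base using (1ℙ)
open import Data.Product.Base using (_×_; _,_; proj₁; proj₂; ∃₂; ∃-syntax)
open import Data.Sum.Base using (_⊎_; inj₁; inj₂)
open import Data.Vec.Base using (Vec; []; _∷_; map; zipWith; replicate; tabulate)
open import Data.Vec.Properties using (∷-injective; ∷-injectiveˡ; ∷-injectiveʳ)
open import Function.Base using (_∘_; case_of_)
open import Function.Bundles using (mk⇔)
open import Relation.Binary.PropositionalEquality
open import Relation.Nullary.Decidable using (Dec; does; yes; no; True; toWitness; ¬?; _→-dec_; _×-dec_; does-⇔; dec-true; dec-false)
open import Relation.Nullary.Negation.Core using (¬_; contradiction)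
open import Algebra.Properties.AbelianGroup ℤ.+-0-abelianGroup using (∙-cancelʳ)
open import Algebra.Properties.Semiring.Sum ℤ.+-*-semiring
  using (sum; sum-syntax; sum-cong-≗; sum-permute; ∑-distrib-+; ∑-comm; *-distribˡ-sum; *-distribʳ-sum; sum-replicate-zero)
open Graph
open ≡-Reasoning

-- The field with five elements

𝔽 : Set
𝔽 = Fin 5

infixl 6 _⊕_ _⊝_
infixl 7 _⊗_

_⊕_ _⊗_ _⊝_ : 𝔽 → 𝔽 → 𝔽
x ⊕ y = (toℕ x ℕ.+ toℕ y) mod 5
x ⊗ y = (toℕ x ℕ.* toℕ y) mod 5
x ⊝ y = x ⊕ 4F ⊗ y

instance
  ≡?-𝔽 : {x y : 𝔽} → Dec (x ≡ y)
  ≡?-𝔽 = _ ≟ _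

  ≡?-ℤ : {x y : ℤ} → Dec (x ≡ y)
  ≡?-ℤ = _ ℤ.≟ _

  ≢⇒? : ∀ {a} {x y : 𝔽} {A : Set a} → ⦃ Dec A ⦄ → Dec (x ≢ y → A)
  ≢⇒? ⦃ A? ⦄ = ¬? (_ ≟ _) →-dec A?

  ≡⇒? : ∀ {a} {x y : 𝔽} {A : Set a} → ⦃ Dec A ⦄ → Dec (x ≡ y → A)
  ≡⇒? ⦃ A? ⦄ = (_ ≟ _) →-dec A?

  ∀𝔽? : ∀ {a} {P : 𝔽 → Set a} → ⦃ ∀ {x} → Dec (P x) ⦄ → Dec (∀ x → P x)
  ∀𝔽? ⦃ P? ⦄ = all? λ x → P?

-- Instance search follows the shape of the statement and assembles its decision procedure; the
-- implicit `True` is then solved by evaluation. A closed statement quantified over 𝔽 is thus proved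
-- by running through all cases.
decide : ∀ {a} {A : Set a} ⦃ A? : Dec A ⦄ → {True A?} → A
decide {_} ⦃ _ ⦄ {t} = toWitness t

-- x³ = x⁻¹ by Fermat; inv 0 = 0.
inv : 𝔽 → 𝔽
inv x = x ⊗ x ⊗ x

-- The quadratic character modulo 5. Note that -1 = `4F` is a square.
χ : 𝔽 → ℤ
χ 0F = 0ℤ
χ 1F = 1ℤ
χ 2F = -1ℤ
χ 3F = -1ℤ
χ 4F = 1ℤ

⟦_⟧ : Bool → ℤ
⟦ true ⟧  = 1ℤ
⟦ false ⟧ = 0ℤ

δ : ∀ {n} → Fin n → Fin n → ℤ
δ i j = ⟦ does (i ≟ j) ⟧

∑-δ : ∀ {n} (g : Fin n → ℤ) i → ∑[ j < n ] (δ i j * g j) ≡ g i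
∑-δ {suc n} g 0F = begin
  1ℤ * g 0F + ∑[ j < n ] (0ℤ * g (Fin.suc j)) ≡⟨ cong₂ _+_ (ℤ.*-identityˡ (g 0F)) (sum-replicate-zero n) ⟩
  g 0F + 0ℤ                                    ≡⟨ ℤ.+-identityʳ _ ⟩
  g 0F                                         ∎
∑-δ {suc n} g (Fin.suc i) = trans (ℤ.+-identityˡ _) (∑-δ (g ∘ Fin.suc) i)

⊝-⊕ : ∀ a c → (a ⊝ c) ⊕ c ≡ a
⊝-⊕ = decide

⊕-⊝ : ∀ a c → (a ⊕ c) ⊝ c ≡ a
⊕-⊝ = decide

∑-shift : ∀ (f : 𝔽 → ℤ) c → ∑[ a < 5 ] f a ≡ ∑[ a < 5 ] f (a ⊕ c)
∑-shift f c = sum-permute f (permutation (_⊕ c) (_⊝ c)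
  (λ a → ⊝-⊕ a c) (λ a → ⊕-⊝ a c))

-- The distribution of ρ t² convolved with itself is 5 δ₀ + 4, so up to the
-- factor 25 this kernel inverts T.
κ : 𝔽 → 𝔽 → 𝔽 → ℤ
κ ρ q p = + 5 * ∑[ t < 5 ] δ (q ⊝ ρ ⊗ (t ⊗ t)) p - + 4

-- Adding one coordinate of coefficient ρ to a quadratic form acts on its value distribution by this
-- operator. It occurs with ρ = d in `#Q-suc`, and with ρ = 1/Q z when the line spanned by z is
-- split off.
T : 𝔽 → (𝔽 → ℤ) → 𝔽 → ℤ
T ρ g q = ∑[ t < 5 ] g (q ⊝ ρ ⊗ (t ⊗ t))


-- As -1 is a square, s² + t² is a hyperbolic plane: it represents 0 nine times and every other
-- value four times. This is the convolution 5 δ₀ + 4, and scaling by ρ does not change it.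
T-inverse : ∀ ρ → ρ ≢ 0F → ∀ q x →
  ∑[ p < 5 ] ∑[ t < 5 ] (κ ρ q p * δ (p ⊝ ρ ⊗ (t ⊗ t)) x) ≡ + 25 * δ q x
T-inverse = decide

-- An arbitrary integer-valued `g` is out of reach of `decide`; writing it as a combination of point
-- masses reduces the claim to `T-inverse`, where only elements of 𝔽 occur.
T-invertible : ∀ ρ → ρ ≢ 0F → ∀ g q → ∑[ p < 5 ] (κ ρ q p * T ρ g p) ≡ + 25 * g q
T-invertible ρ ρ≢0 g q = begin
  ∑[ p < 5 ] (κ ρ q p * ∑[ t < 5 ] g (y p t))
    ≡⟨ sum-cong-≗ (λ p → trans (*-distribˡ-sum (κ ρ q p) (λ t → g (y p t)))
         (sum-cong-≗ λ t → trans (cong (κ ρ q p *_) (sym (∑-δ g (y p t))))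
           (trans (*-distribˡ-sum (κ ρ q p) (λ x → δ (y p t) x * g x))
             (sum-cong-≗ λ x → sym (ℤ.*-assoc (κ ρ q p) (δ (y p t) x) (g x)))))) ⟩
  ∑[ p < 5 ] ∑[ t < 5 ] ∑[ x < 5 ] (κ ρ q p * δ (y p t) x * g x)
    ≡⟨ sum-cong-≗ (λ p → ∑-comm λ t x → κ ρ q p * δ (y p t) x * g x) ⟩
  ∑[ p < 5 ] ∑[ x < 5 ] ∑[ t < 5 ] (κ ρ q p * δ (y p t) x * g x)
    ≡⟨ ∑-comm (λ p x → ∑[ t < 5 ] (κ ρ q p * δ (y p t) x * g x)) ⟩
  ∑[ x < 5 ] ∑[ p < 5 ] ∑[ t < 5 ] (κ ρ q p * δ (y p t) x * g x)
    ≡⟨ sum-cong-≗ (λ x → trans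
         (sum-cong-≗ λ p → sym (*-distribʳ-sum (g x) λ t → κ ρ q p * δ (y p t) x))
         (sym (*-distribʳ-sum (g x) λ p → ∑[ t < 5 ] (κ ρ q p * δ (y p t) x)))) ⟩
  ∑[ x < 5 ] (∑[ p < 5 ] ∑[ t < 5 ] (κ ρ q p * δ (y p t) x) * g x)
    ≡⟨ sum-cong-≗ (λ x → trans (cong (_* g x) (T-inverse ρ ρ≢0 q x)) (ℤ.*-assoc (+ 25) (δ q x) (g x))) ⟩
  ∑[ x < 5 ] (+ 25 * (δ q x * g x))
    ≡⟨ *-distribˡ-sum (+ 25) (λ x → δ q x * g x) ⟨
  + 25 * ∑[ x < 5 ] (δ q x * g x)
    ≡⟨ cong (+ 25 *_) (∑-δ g q) ⟩
  + 25 * g q ∎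
  where
  y : 𝔽 → 𝔽 → 𝔽
  y p t = p ⊝ ρ ⊗ (t ⊗ t)

T-injective : ∀ ρ → ρ ≢ 0F → ∀ g h → (∀ q → T ρ g q ≡ T ρ h q) → ∀ q → g q ≡ h q
T-injective ρ ρ≢0 g h Tg≡Th q = ℤ.*-cancelˡ-≡ (+ 25) (g q) (h q) (begin
  + 25 * g q                         ≡⟨ T-invertible ρ ρ≢0 g q ⟨
  ∑[ p < 5 ] (κ ρ q p * T ρ g p)     ≡⟨ sum-cong-≗ (λ p → cong (κ ρ q p *_) (Tg≡Th p)) ⟩
  ∑[ p < 5 ] (κ ρ q p * T ρ h p)     ≡⟨ T-invertible ρ ρ≢0 h q ⟩
  + 25 * h q                         ∎)

T-cong : ∀ ρ {g h} → g ≗ h → T ρ g ≗ T ρ h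
T-cong ρ g≗h q = sum-cong-≗ {5} λ t → g≗h (q ⊝ ρ ⊗ (t ⊗ t))

∑-affine : ∀ a e (u : 𝔽 → ℤ) → ∑[ t < 5 ] (a + e * u t) ≡ + 5 * a + e * sum u
∑-affine a e u = begin
  ∑[ t < 5 ] (a + e * u t)            ≡⟨ ∑-distrib-+ (λ _ → a) (λ t → e * u t) ⟩
  ∑[ t < 5 ] a + ∑[ t < 5 ] (e * u t) ≡⟨ cong₂ _+_ (five a) (sym (*-distribˡ-sum e u)) ⟩
  + 5 * a + e * sum u                 ∎
  where
  five : ∀ a → a + (a + (a + (a + (a + 0ℤ)))) ≡ + 5 * a
  five = solve-∀

∑-const : ∀ {a} {u : 𝔽 → ℤ} → (∀ t → u t ≡ a) → sum u ≡ + 5 * a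
∑-const {a} {u} u≡a = begin
  sum u                                ≡⟨ sum-cong-≗ (λ t → trans (u≡a t) (sym (ℤ.+-identityʳ a))) ⟩
  ∑[ t < 5 ] (a + 0ℤ * 0ℤ)             ≡⟨ ∑-affine a 0ℤ (λ _ → 0ℤ) ⟩
  + 5 * a + 0ℤ                         ≡⟨ ℤ.+-identityʳ _ ⟩
  + 5 * a                              ∎

∑-δʳ : ∀ {n} (a b : ℤ) (i : Fin n) → ∑[ j < n ] (a * (b * δ i j)) ≡ a * b
∑-δʳ a b i = trans (sum-cong-≗ λ j → rearrange a b (δ i j)) (∑-δ (λ _ → a * b) i)
  where
  rearrange : ∀ a b c → a * (b * c) ≡ c * (a * b)
  rearrange = solve-∀

-- Vectors over 𝔽

-- Opaque so that unification can recover n from sumⱽ {n} f.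
opaque
  sumⱽ : ∀ {n} → (Vec 𝔽 n → ℤ) → ℤ
  sumⱽ {zero}  f = f []
  sumⱽ {suc n} f = ∑[ a < 5 ] sumⱽ (λ w → f (a ∷ w))

  sumⱽ-cong : ∀ {n} {f g : Vec 𝔽 n → ℤ} → f ≗ g → sumⱽ f ≡ sumⱽ g
  sumⱽ-cong {zero}  f≗g = f≗g []
  sumⱽ-cong {suc n} f≗g = sum-cong-≗ λ a → sumⱽ-cong λ w → f≗g (a ∷ w)

  sumⱽ-distrib-+ : ∀ {n} (f g : Vec 𝔽 n → ℤ) → sumⱽ (λ w → f w + g w) ≡ sumⱽ f + sumⱽ g
  sumⱽ-distrib-+ {zero}  f g = refl
  sumⱽ-distrib-+ {suc n} f g = trans
    (sum-cong-≗ λ a → sumⱽ-distrib-+ (λ w → f (a ∷ w)) (λ w → g (a ∷ w)))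
    (∑-distrib-+ (λ a → sumⱽ (λ w → f (a ∷ w))) (λ a → sumⱽ (λ w → g (a ∷ w))))

  *-distribˡ-sumⱽ : ∀ {n} c (f : Vec 𝔽 n → ℤ) → c * sumⱽ f ≡ sumⱽ (λ w → c * f w)
  *-distribˡ-sumⱽ {zero}  c f = refl
  *-distribˡ-sumⱽ {suc n} c f = trans
    (*-distribˡ-sum c (λ a → sumⱽ (λ w → f (a ∷ w))))
    (sum-cong-≗ λ a → *-distribˡ-sumⱽ c (λ w → f (a ∷ w)))

  sumⱽ-∑-comm : ∀ {m n} (f : Fin m → Vec 𝔽 n → ℤ) →
    sumⱽ (λ w → ∑[ i < m ] f i w) ≡ ∑[ i < m ] sumⱽ (f i)
  sumⱽ-∑-comm {n = zero}  f = refl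
  sumⱽ-∑-comm {n = suc n} f = trans
    (sum-cong-≗ λ a → sumⱽ-∑-comm (λ i w → f i (a ∷ w)))
    (∑-comm (λ a i → sumⱽ (λ w → f i (a ∷ w))))

infixl 6 _⊞_
infixl 7 _⊡_

_⊞_ : ∀ {n} → Vec 𝔽 n → Vec 𝔽 n → Vec 𝔽 n
_⊞_ = zipWith _⊕_

_⊡_ : ∀ {n} → 𝔽 → Vec 𝔽 n → Vec 𝔽 n
c ⊡ w = map (c ⊗_) w

𝟎 : ∀ {n} → Vec 𝔽 n
𝟎 = replicate _ 0F

opaque
  unfolding sumⱽ

  sumⱽ-translate : ∀ {n} (f : Vec 𝔽 n → ℤ) u → sumⱽ f ≡ sumⱽ (λ w → f (w ⊞ u))
  sumⱽ-translate f []      = refl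
  sumⱽ-translate f (c ∷ u) = trans
    (∑-shift (λ a → sumⱽ (λ w → f (a ∷ w))) c)
    (sum-cong-≗ λ a → sumⱽ-translate (λ w → f (a ⊕ c ∷ w)) u)

negate-involutive : ∀ a → 4F ⊗ (4F ⊗ a) ≡ a
negate-involutive = decide

opaque
  unfolding sumⱽ

  sumⱽ-negate : ∀ {n} (f : Vec 𝔽 n → ℤ) → sumⱽ f ≡ sumⱽ (λ w → f (4F ⊡ w))
  sumⱽ-negate {zero}  f = refl
  sumⱽ-negate {suc n} f = trans
    (sum-permute (λ a → sumⱽ (λ w → f (a ∷ w)))
      (permutation (4F ⊗_) (4F ⊗_) negate-involutive negate-involutive))
    (sum-cong-≗ λ a → sumⱽ-negate (λ w → f (4F ⊗ a ∷ w)))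

1⊡ : ∀ {n} (x : Vec 𝔽 n) → 1F ⊡ x ≡ x
1⊡ []      = refl
1⊡ (a ∷ x) = cong₂ _∷_ (1⊗ a) (1⊡ x)
  where
  1⊗ : ∀ a → 1F ⊗ a ≡ a
  1⊗ = decide

⊞-negate⁻ : ∀ {n} c (x y : Vec 𝔽 n) → y ⊞ (4F ⊗ c) ⊡ x ≡ 𝟎 → y ≡ c ⊡ x
⊞-negate⁻ c []      []      _  = refl
⊞-negate⁻ c (a ∷ x) (b ∷ y) eq = cong₂ _∷_ (cancel a b c (∷-injectiveˡ eq)) (⊞-negate⁻ c x y (∷-injectiveʳ eq))
  where
  cancel : ∀ a b c → b ⊕ (4F ⊗ c) ⊗ a ≡ 0F → b ≡ c ⊗ a
  cancel = decide

-- The quadratic form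

module Form (d : 𝔽) (d≢0 : d ≢ 0F) where

  B : ∀ {n} → Vec 𝔽 n → Vec 𝔽 n → 𝔽
  B []      []      = 0F
  B (a ∷ w) (b ∷ x) = d ⊗ (a ⊗ b) ⊕ B w x

  Q : ∀ {n} → Vec 𝔽 n → 𝔽
  Q w = B w w

  B-sym : ∀ {n} (w x : Vec 𝔽 n) → B w x ≡ B x w
  B-sym []      []      = refl
  B-sym (a ∷ w) (b ∷ x) = cong₂ (λ p q → d ⊗ p ⊕ q) (⊗-comm a b) (B-sym w x)
    where
    ⊗-comm : ∀ a b → a ⊗ b ≡ b ⊗ a
    ⊗-comm = decide

  B-⊞ˡ : ∀ {n} (w u x : Vec 𝔽 n) → B (w ⊞ u) x ≡ B w x ⊕ B u x
  B-⊞ˡ []      []      []      = refl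
  B-⊞ˡ (a ∷ w) (c ∷ u) (b ∷ x) = begin
    d ⊗ ((a ⊕ c) ⊗ b) ⊕ B (w ⊞ u) x
      ≡⟨ cong₂ _⊕_ (distrib d a c b) (B-⊞ˡ w u x) ⟩
    (d ⊗ (a ⊗ b) ⊕ d ⊗ (c ⊗ b)) ⊕ (B w x ⊕ B u x)
      ≡⟨ interchange (d ⊗ (a ⊗ b)) (d ⊗ (c ⊗ b)) (B w x) (B u x) ⟩
    (d ⊗ (a ⊗ b) ⊕ B w x) ⊕ (d ⊗ (c ⊗ b) ⊕ B u x) ∎
    where
    distrib : ∀ d a c b → d ⊗ ((a ⊕ c) ⊗ b) ≡ d ⊗ (a ⊗ b) ⊕ d ⊗ (c ⊗ b)
    distrib = decide
    interchange : ∀ p q r s → (p ⊕ q) ⊕ (r ⊕ s) ≡ (p ⊕ r) ⊕ (q ⊕ s)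
    interchange = decide

  B-⊡ˡ : ∀ {n} c (w x : Vec 𝔽 n) → B (c ⊡ w) x ≡ c ⊗ B w x
  B-⊡ˡ c []      []      = ⊗-zeroʳ c
    where
    ⊗-zeroʳ : ∀ c → 0F ≡ c ⊗ 0F
    ⊗-zeroʳ = decide
  B-⊡ˡ c (a ∷ w) (b ∷ x) = begin
    d ⊗ ((c ⊗ a) ⊗ b) ⊕ B (c ⊡ w) x ≡⟨ cong₂ _⊕_ (pull d c a b) (B-⊡ˡ c w x) ⟩
    c ⊗ (d ⊗ (a ⊗ b)) ⊕ c ⊗ B w x   ≡⟨ distrib c (d ⊗ (a ⊗ b)) (B w x) ⟩
    c ⊗ (d ⊗ (a ⊗ b) ⊕ B w x)       ∎
    where
    pull : ∀ d c a b → d ⊗ ((c ⊗ a) ⊗ b) ≡ c ⊗ (d ⊗ (a ⊗ b))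
    pull = decide
    distrib : ∀ c p q → c ⊗ p ⊕ c ⊗ q ≡ c ⊗ (p ⊕ q)
    distrib = decide

  B-translate : ∀ {n} c (w u x : Vec 𝔽 n) → B (w ⊞ c ⊡ u) x ≡ B w x ⊕ c ⊗ B u x
  B-translate c w u x = trans (B-⊞ˡ w (c ⊡ u) x) (cong (B w x ⊕_) (B-⊡ˡ c u x))

  Q-translate : ∀ {n} c (w z : Vec 𝔽 n) →
    Q (w ⊞ c ⊡ z) ≡ (Q w ⊕ c ⊗ (2F ⊗ B w z)) ⊕ (c ⊗ c) ⊗ Q z
  Q-translate c w z = begin
    Q (w ⊞ c ⊡ z)
      ≡⟨ B-translate c w z (w ⊞ c ⊡ z) ⟩
    B w (w ⊞ c ⊡ z) ⊕ c ⊗ B z (w ⊞ c ⊡ z)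
      ≡⟨ cong₂ (λ p q → p ⊕ c ⊗ q) (B-sym w (w ⊞ c ⊡ z)) (B-sym z (w ⊞ c ⊡ z)) ⟩
    B (w ⊞ c ⊡ z) w ⊕ c ⊗ B (w ⊞ c ⊡ z) z
      ≡⟨ cong₂ (λ p q → p ⊕ c ⊗ q) (B-translate c w z w) (B-translate c w z z) ⟩
    (Q w ⊕ c ⊗ B z w) ⊕ c ⊗ (B w z ⊕ c ⊗ Q z)
      ≡⟨ cong (λ b → (Q w ⊕ c ⊗ b) ⊕ c ⊗ (B w z ⊕ c ⊗ Q z)) (B-sym z w) ⟩
    (Q w ⊕ c ⊗ B w z) ⊕ c ⊗ (B w z ⊕ c ⊗ Q z)
      ≡⟨ expand (Q w) c (B w z) (Q z) ⟩
    (Q w ⊕ c ⊗ (2F ⊗ B w z)) ⊕ (c ⊗ c) ⊗ Q z ∎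
    where
    expand : ∀ p c b r → (p ⊕ c ⊗ b) ⊕ c ⊗ (b ⊕ c ⊗ r) ≡ (p ⊕ c ⊗ (2F ⊗ b)) ⊕ (c ⊗ c) ⊗ r
    expand = decide

  B-𝟎ˡ : ∀ {n} (x : Vec 𝔽 n) → B 𝟎 x ≡ 0F
  B-𝟎ˡ []      = refl
  B-𝟎ˡ (b ∷ x) = trans (cong (d ⊗ (0F ⊗ b) ⊕_) (B-𝟎ˡ x)) (vanish d b)
    where
    vanish : ∀ d b → d ⊗ (0F ⊗ b) ⊕ 0F ≡ 0F
    vanish = decide

  -- The witness is supported on the first non-zero coordinate of `z`, scaled by an inverse.
  B-nondegenerate : ∀ {n} (z : Vec 𝔽 n) → z ≢ 𝟎 → ∃[ u ] B u z ≡ 1F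
  B-nondegenerate []      z≢𝟎 = contradiction refl z≢𝟎
  B-nondegenerate (a ∷ z) z≢𝟎 with a ≟ 0F
  ... | no a≢0 = inv (d ⊗ a) ∷ 𝟎 , trans (cong (d ⊗ (inv (d ⊗ a) ⊗ a) ⊕_) (B-𝟎ˡ z)) (invert d d≢0 a a≢0)
    where
    invert : ∀ d → d ≢ 0F → ∀ a → a ≢ 0F → d ⊗ (inv (d ⊗ a) ⊗ a) ⊕ 0F ≡ 1F
    invert = decide
  ... | yes refl with B-nondegenerate z (λ z≡𝟎 → z≢𝟎 (cong (0F ∷_) z≡𝟎))
  ...   | u , Buz≡1 = 0F ∷ u , trans (cong (d ⊗ (0F ⊗ 0F) ⊕_) Buz≡1) (vanish d)
    where
    vanish : ∀ d → d ⊗ (0F ⊗ 0F) ⊕ 1F ≡ 1F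
    vanish = decide

  -- Counting solutions of quadratic equations

  #Q : ∀ n → 𝔽 → ℤ
  #Q n q = sumⱽ {n} λ w → δ (Q w) q

  opaque
    unfolding sumⱽ

    #Q-zero : ∀ q → #Q 0 q ≡ δ 0F q
    #Q-zero q = refl

    #Q-suc : ∀ n q → #Q (suc n) q ≡ T d (#Q n) q
    #Q-suc n q = sum-cong-≗ {5} λ a → sumⱽ-cong {n} λ w → move d a (Q w) q
      where
      move : ∀ d a b q → δ (d ⊗ (a ⊗ a) ⊕ b) q ≡ δ b (q ⊝ d ⊗ (a ⊗ a))
      move = decide

  -- Coordinates are added in pairs: one application of `T d` turns χ into a multiple of 5 δ₀ - 1,
  -- and the second returns 5 χ, since s² + t² is hyperbolic and χ sums to zero. In the base case, d
  -- t² = q has 1 + χ d χ q solutions.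
  #Q-formula : ∀ m q →
    #Q (1 ℕ.+ m ℕ.* 2) q ≡ (+ 5) ^ m * (+ 5) ^ m + (χ d * (+ 5) ^ m) * χ q
  #Q-formula zero    q = trans (#Q-suc 0 q) (trans (T-cong d #Q-zero q) (base d d≢0 q))
    where
    base : ∀ d → d ≢ 0F → ∀ q → T d (δ 0F) q ≡ + 1 * + 1 + (χ d * + 1) * χ q
    base = decide
  #Q-formula (suc m) q = begin
    #Q (3 ℕ.+ m ℕ.* 2) q
      ≡⟨ #Q-suc (2 ℕ.+ m ℕ.* 2) q ⟩
    T d (#Q (2 ℕ.+ m ℕ.* 2)) q
      ≡⟨ T-cong d (#Q-suc (1 ℕ.+ m ℕ.* 2)) q ⟩
    T d (T d (#Q (1 ℕ.+ m ℕ.* 2))) q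
      ≡⟨ T-cong d (T-cong d (#Q-formula m)) q ⟩
    T d (T d (λ q → A + E * χ q)) q
      ≡⟨ T-cong d (λ q → ∑-affine A E (λ t → χ (q ⊝ d ⊗ (t ⊗ t)))) q ⟩
    T d (λ q → + 5 * A + E * T d χ q) q
      ≡⟨ ∑-affine (+ 5 * A) E (λ t → T d χ (q ⊝ d ⊗ (t ⊗ t))) ⟩
    + 5 * (+ 5 * A) + E * T d (T d χ) q
      ≡⟨ cong (λ v → + 5 * (+ 5 * A) + E * v) (square d d≢0 q) ⟩
    + 5 * (+ 5 * A) + E * (+ 5 * χ q)
      ≡⟨ collect ((+ 5) ^ m) (χ d) (χ q) ⟩
    + 5 * (+ 5) ^ m * (+ 5 * (+ 5) ^ m) + (χ d * (+ 5 * (+ 5) ^ m)) * χ q ∎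
    where
    A = (+ 5) ^ m * (+ 5) ^ m
    E = χ d * (+ 5) ^ m
    square : ∀ d → d ≢ 0F → ∀ q → T d (T d χ) q ≡ + 5 * χ q
    square = decide
    collect : ∀ K ε c → + 5 * (+ 5 * (K * K)) + (ε * K) * (+ 5 * c) ≡ + 5 * K * (+ 5 * K) + (ε * (+ 5 * K)) * c
    collect = solve-∀

  module _ {n : ℕ} where

    -- The weight `m` carries conditions imposed earlier, such as B w x = s, so that the same lemmas
    -- add the first and the second linear condition. All they ask of `m` is invariance under the
    -- translations used.
    # : (Vec 𝔽 n → ℤ) → Vec 𝔽 n → 𝔽 → 𝔽 → ℤ
    # m z q t = sumⱽ λ w → m w * (δ (Q w) q * δ (B w z) t)

    Invariant : Vec 𝔽 n → (Vec 𝔽 n → ℤ) → Set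
    Invariant z m = ∀ c w → m (w ⊞ c ⊡ z) ≡ m w

    B-invariant : ∀ {u x : Vec 𝔽 n} → B u x ≡ 0F → ∀ s → Invariant u (λ w → δ (B w x) s)
    B-invariant {u} {x} u⊥x s c w = cong (λ b → δ b s) (begin
      B (w ⊞ c ⊡ u) x     ≡⟨ B-translate c w u x ⟩
      B w x ⊕ c ⊗ B u x   ≡⟨ cong (λ b → B w x ⊕ c ⊗ b) u⊥x ⟩
      B w x ⊕ c ⊗ 0F      ≡⟨ vanish (B w x) c ⟩
      B w x               ∎)
      where
      vanish : ∀ b c → b ⊕ c ⊗ 0F ≡ b
      vanish = decide

    ∑-# : ∀ m z q → ∑[ t < 5 ] # m z q t ≡ sumⱽ (λ w → m w * δ (Q w) q)
    ∑-# m z q = trans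
      (sym (sumⱽ-∑-comm λ t w → m w * (δ (Q w) q * δ (B w z) t)))
      (sumⱽ-cong λ w → ∑-δʳ (m w) (δ (Q w) q) (B w z))

    #-translate : ∀ m z → Invariant z m → ∀ c q t → # m z q t ≡
      sumⱽ (λ w → m w * (δ ((Q w ⊕ c ⊗ (2F ⊗ B w z)) ⊕ (c ⊗ c) ⊗ Q z) q * δ (B w z ⊕ c ⊗ Q z) t))
    #-translate m z inv-m c q t = trans
      (sumⱽ-translate (λ w → m w * (δ (Q w) q * δ (B w z) t)) (c ⊡ z))
      (sumⱽ-cong λ w → cong₂ _*_ (inv-m c w)
        (cong₂ (λ p b → δ p q * δ b t) (Q-translate c w z) (B-translate c w z z)))

    -- Completing the square: translation along z turns the condition
    -- B w z = t into B w z = 0, and the counts with B w z = 0 are then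
    -- determined by their image under the invertible operator T.
    #-anisotropic : ∀ m z r → Q z ≡ r → r ≢ 0F → Invariant z m →
      ∀ g → (∀ q → sumⱽ (λ w → m w * δ (Q w) q) ≡ T (inv r) g q) →
      ∀ q t → # m z q t ≡ g (q ⊝ inv r ⊗ (t ⊗ t))
    #-anisotropic m z r refl r≢0 inv-m g total q t =
      trans (complete q t) (T-injective (inv r) (inv≢0 r r≢0) (λ q → # m z q 0F) g same _)
      where
      inv≢0 : ∀ r → r ≢ 0F → inv r ≢ 0F
      inv≢0 r r≢0 eq = r≢0 (inv≡0 r eq)
        where
        inv≡0 : ∀ r → inv r ≡ 0F → r ≡ 0F
        inv≡0 = decide
      square : ∀ r → r ≢ 0F → ∀ t q p b →
        δ ((p ⊕ (t ⊗ inv r) ⊗ (2F ⊗ b)) ⊕ ((t ⊗ inv r) ⊗ (t ⊗ inv r)) ⊗ r) q * δ (b ⊕ (t ⊗ inv r) ⊗ r) t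
          ≡ δ p (q ⊝ inv r ⊗ (t ⊗ t)) * δ b 0F
      square = decide
      complete : ∀ q t → # m z q t ≡ # m z (q ⊝ inv r ⊗ (t ⊗ t)) 0F
      complete q t = trans (#-translate m z inv-m (t ⊗ inv r) q t)
        (sumⱽ-cong λ w → cong (m w *_) (square r r≢0 t q (Q w) (B w z)))
      same : ∀ q → T (inv r) (λ q → # m z q 0F) q ≡ T (inv r) g q
      same q = begin
        T (inv r) (λ q → # m z q 0F) q     ≡⟨ sum-cong-≗ (λ t → complete q t) ⟨
        ∑[ t < 5 ] # m z q t               ≡⟨ ∑-# m z q ⟩
        sumⱽ (λ w → m w * δ (Q w) q)       ≡⟨ total q ⟩
        T (inv r) g q                      ∎

    -- Translation by (s - t) u moves B w z from t to s and fixes `m`, so the five values share the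
    -- total equally.
    linear-uniform : ∀ m z u → B u z ≡ 1F → Invariant u m →
      ∀ t → + 5 * sumⱽ (λ w → m w * δ (B w z) t) ≡ sumⱽ m
    linear-uniform m z u Buz≡1 inv-m t = begin
      + 5 * L t                                       ≡⟨ ∑-const const ⟨
      ∑[ s < 5 ] L s                                  ≡⟨ sumⱽ-∑-comm (λ s w → m w * δ (B w z) s) ⟨
      sumⱽ (λ w → ∑[ s < 5 ] (m w * δ (B w z) s))     ≡⟨ sumⱽ-cong (λ w → trans
                                                          (sum-cong-≗ λ s → ℤ.*-comm (m w) (δ (B w z) s))
                                                          (∑-δ (λ _ → m w) (B w z))) ⟩
      sumⱽ m                                          ∎
      where
      L : 𝔽 → ℤ
      L t = sumⱽ (λ w → m w * δ (B w z) t)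
      move : ∀ b s t → δ (b ⊕ (s ⊝ t) ⊗ 1F) s ≡ δ b t
      move = decide
      const : ∀ s → L s ≡ L t
      const s = trans (sumⱽ-translate (λ w → m w * δ (B w z) s) ((s ⊝ t) ⊡ u))
        (sumⱽ-cong λ w → cong₂ _*_ (inv-m (s ⊝ t) w) (trans
          (cong (λ b → δ b s) (trans (B-translate (s ⊝ t) w u z) (cong (λ b → B w z ⊕ (s ⊝ t) ⊗ b) Buz≡1)))
          (move (B w z) s t)))

    #-isotropic : ∀ m z → Q z ≡ 0F → Invariant z m → ∀ q t → t ≢ 0F →
      + 5 * # m z q t ≡ sumⱽ (λ w → m w * δ (B w z) t)
    #-isotropic m z Qz≡0 inv-m q t t≢0 = begin
      + 5 * # m z q t                                           ≡⟨ ∑-const (λ p → trans (const p) (sym (const q))) ⟨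
      ∑[ p < 5 ] # m z p t                                      ≡⟨ sumⱽ-∑-comm (λ p w → m w * (δ (Q w) p * δ (B w z) t)) ⟨
      sumⱽ (λ w → ∑[ p < 5 ] (m w * (δ (Q w) p * δ (B w z) t))) ≡⟨ sumⱽ-cong (λ w → trans
                                                                    (sum-cong-≗ λ p → rearrange (m w) (δ (Q w) p) (δ (B w z) t))
                                                                    (∑-δʳ (m w) (δ (B w z) t) (Q w))) ⟩
      sumⱽ (λ w → m w * δ (B w z) t)                            ∎
      where
      rearrange : ∀ a b c → a * (b * c) ≡ a * (c * b)
      rearrange = solve-∀
      -- The multiplier is q / 2t: along an isotropic z it leaves B w z = t alone and raises Q w by
      -- 2t · q / 2t = q, carrying level 0 to level q.
      move : ∀ t → t ≢ 0F → ∀ q p b → δ ((p ⊕ (q ⊗ inv (2F ⊗ t)) ⊗ (2F ⊗ b)) ⊕ ((q ⊗ inv (2F ⊗ t)) ⊗ (q ⊗ inv (2F ⊗ t))) ⊗ 0F) q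
        * δ (b ⊕ (q ⊗ inv (2F ⊗ t)) ⊗ 0F) t ≡ δ p 0F * δ b t
      move = decide
      const : ∀ q → # m z q t ≡ # m z 0F t
      const q = trans (#-translate m z inv-m c q t) (sumⱽ-cong λ w → cong (m w *_) (trans
        (cong (λ r → δ ((Q w ⊕ c ⊗ (2F ⊗ B w z)) ⊕ (c ⊗ c) ⊗ r) q * δ (B w z ⊕ c ⊗ r) t) Qz≡0)
        (move t t≢0 q (Q w) (B w z))))
        where c = q ⊗ inv (2F ⊗ t)

-- A unit vector x has 5 A + E u₁ q s vectors w with Q w = q and B w x = s;
-- if z ⊥ x is nonzero with Q z = r, then A + E u₂ r q s t of them have B w z = t.
-- At most one summand of u₂ is nonzero, as χ 0 = 0.
u₁ : 𝔽 → 𝔽 → ℤ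
u₁ q s = + 5 * δ (q ⊝ s ⊗ s) 0F - 1ℤ

u₂ : 𝔽 → 𝔽 → 𝔽 → 𝔽 → ℤ
u₂ r q s t = δ r 0F * (δ t 0F * u₁ q s) + χ r * χ ((q ⊝ s ⊗ s) ⊝ inv r ⊗ (t ⊗ t))

∑-weighted : ∀ a e (p u : 𝔽 → ℤ) →
  ∑[ t < 5 ] (p t * (a + e * u t)) ≡ a * sum p + e * ∑[ t < 5 ] (p t * u t)
∑-weighted a e p u = begin
  ∑[ t < 5 ] (p t * (a + e * u t))
    ≡⟨ sum-cong-≗ {5} (λ t → distrib a e (p t) (u t)) ⟩
  ∑[ t < 5 ] (a * p t + e * (p t * u t))
    ≡⟨ ∑-distrib-+ (λ t → a * p t) (λ t → e * (p t * u t)) ⟩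
  ∑[ t < 5 ] (a * p t) + ∑[ t < 5 ] (e * (p t * u t))
    ≡⟨ cong₂ _+_ (*-distribˡ-sum a p) (*-distribˡ-sum e (λ t → p t * u t)) ⟨
  a * sum p + e * ∑[ t < 5 ] (p t * u t) ∎
  where
  distrib : ∀ a e p u → p * (a + e * u) ≡ a * p + e * (p * u)
  distrib = solve-∀

∑∑-weighted : ∀ a e (p u : 𝔽 → 𝔽 → ℤ) →
  ∑[ s < 5 ] ∑[ t < 5 ] (p s t * (a + e * u s t)) ≡
  a * (∑[ s < 5 ] ∑[ t < 5 ] p s t) + e * (∑[ s < 5 ] ∑[ t < 5 ] (p s t * u s t))
∑∑-weighted a e p u = begin
  ∑[ s < 5 ] ∑[ t < 5 ] (p s t * (a + e * u s t))
    ≡⟨ sum-cong-≗ {5} (λ s → ∑-weighted a e (p s) (u s)) ⟩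
  ∑[ s < 5 ] (a * sum (p s) + e * sum (λ t → p s t * u s t))
    ≡⟨ ∑-distrib-+ (λ s → a * sum (p s)) (λ s → e * sum (λ t → p s t * u s t)) ⟩
  ∑[ s < 5 ] (a * sum (p s)) + ∑[ s < 5 ] (e * sum (λ t → p s t * u s t))
    ≡⟨ cong₂ _+_ (*-distribˡ-sum a (λ s → sum (p s))) (*-distribˡ-sum e (λ s → sum (λ t → p s t * u s t))) ⟨
  a * (∑[ s < 5 ] ∑[ t < 5 ] p s t) + e * (∑[ s < 5 ] ∑[ t < 5 ] (p s t * u s t)) ∎

-- Counts with one and two linear conditions

-- The factors 25 and 5 are what two linear conditions use up: the main term falls from 25 A to 5 A
-- to A, and the coefficient of the deviation from 5 E to E, where it stays.
module Counts (d : 𝔽) (d≢0 : d ≢ 0F) (n : ℕ) (A E : ℤ)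
  (#Q≡ : ∀ q → Form.#Q d d≢0 n q ≡ + 25 * A + (+ 5 * E) * χ q) where

  open Form d d≢0

  #₁ : ∀ {x : Vec 𝔽 n} → Q x ≡ 1F → ∀ q s →
    sumⱽ (λ w → δ (B w x) s * δ (Q w) q) ≡ + 5 * A + E * u₁ q s
  #₁ {x} Qx≡1 q s = begin
    sumⱽ (λ w → δ (B w x) s * δ (Q w) q)
      ≡⟨ sumⱽ-cong (λ w → swap (δ (B w x) s) (δ (Q w) q)) ⟩
    # (λ _ → 1ℤ) x q s
      ≡⟨ #-anisotropic (λ _ → 1ℤ) x 1F Qx≡1 (λ ()) (λ _ _ → refl) g total q s ⟩
    g (q ⊝ 1F ⊗ (s ⊗ s))
      ≡⟨ cong (λ v → + 5 * A + E * v) (simplify q s) ⟩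
    + 5 * A + E * u₁ q s ∎
    where
    swap : ∀ a b → a * b ≡ 1ℤ * (b * a)
    swap = solve-∀
    simplify : ∀ q s → + 5 * δ (q ⊝ 1F ⊗ (s ⊗ s)) 0F - 1ℤ ≡ u₁ q s
    simplify = decide
    -- The value distribution on the hyperplane orthogonal to x: in even dimension the deviation
    -- from the mean 5 A singles out only the value 0.
    g : 𝔽 → ℤ
    g q = + 5 * A + E * (+ 5 * δ q 0F - 1ℤ)
    table : ∀ q → ∑[ t < 5 ] (+ 5 * δ (q ⊝ 1F ⊗ (t ⊗ t)) 0F - 1ℤ) ≡ + 5 * χ q
    table = decide
    collect : ∀ A E c → + 25 * A + (+ 5 * E) * c ≡ + 5 * (+ 5 * A) + E * (+ 5 * c)
    collect = solve-∀
    total : ∀ q → sumⱽ (λ w → 1ℤ * δ (Q w) q) ≡ T 1F g q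
    total q = begin
      sumⱽ (λ w → 1ℤ * δ (Q w) q)         ≡⟨ sumⱽ-cong (λ w → ℤ.*-identityˡ (δ (Q w) q)) ⟩
      #Q n q                              ≡⟨ #Q≡ q ⟩
      + 25 * A + (+ 5 * E) * χ q          ≡⟨ collect A E (χ q) ⟩
      + 5 * (+ 5 * A) + E * (+ 5 * χ q)   ≡⟨ cong (λ v → + 5 * (+ 5 * A) + E * v) (table q) ⟨
      + 5 * (+ 5 * A) + E * _             ≡⟨ ∑-affine (+ 5 * A) E (λ t → + 5 * δ (q ⊝ 1F ⊗ (t ⊗ t)) 0F - 1ℤ) ⟨
      T 1F g q                            ∎

  module _ {x z : Vec 𝔽 n} (Qx≡1 : Q x ≡ 1F) (z⊥x : B z x ≡ 0F) (z≢𝟎 : z ≢ 𝟎) where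

    m : 𝔽 → Vec 𝔽 n → ℤ
    m s w = δ (B w x) s

    #₂-anisotropic : Q z ≢ 0F → ∀ q s t → # (m s) z q t ≡ A + E * u₂ (Q z) q s t
    #₂-anisotropic Qz≢0 q s t = trans
      (#-anisotropic (m s) z (Q z) refl Qz≢0 (B-invariant z⊥x s) g total q t)
      (cong (λ v → A + E * v) (simplify (Q z) Qz≢0 q s t))
      where
      -- The value distribution on the complement of x and z, where q - s² is left after the
      -- component along x. That space has odd dimension again, and χ (Q z) is the change of its
      -- discriminant.
      g : 𝔽 → ℤ
      g q = A + E * (χ (Q z) * χ (q ⊝ s ⊗ s))
      simplify : ∀ r → r ≢ 0F → ∀ q s t → χ r * χ ((q ⊝ inv r ⊗ (t ⊗ t)) ⊝ s ⊗ s) ≡ u₂ r q s t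
      simplify = decide
      table : ∀ r → r ≢ 0F → ∀ q s → u₁ q s ≡ ∑[ t < 5 ] (χ r * χ ((q ⊝ inv r ⊗ (t ⊗ t)) ⊝ s ⊗ s))
      table = decide
      total : ∀ q → sumⱽ (λ w → m s w * δ (Q w) q) ≡ T (inv (Q z)) g q
      total q = begin
        sumⱽ (λ w → m s w * δ (Q w) q)  ≡⟨ #₁ {x} Qx≡1 q s ⟩
        + 5 * A + E * u₁ q s            ≡⟨ cong (λ v → + 5 * A + E * v) (table (Q z) Qz≢0 q s) ⟩
        + 5 * A + E * _                 ≡⟨ ∑-affine A E (λ t → χ (Q z) * χ ((q ⊝ inv (Q z) ⊗ (t ⊗ t)) ⊝ s ⊗ s)) ⟨
        T (inv (Q z)) g q               ∎

    -- Summing `#₁` over all values of Q cancels the deviation, as `u₁` has mean zero in q.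
    sum-m : ∀ s → sumⱽ (m s) ≡ + 25 * A
    sum-m s = begin
      sumⱽ (m s)                                    ≡⟨ sumⱽ-cong (λ w → select (m s w) (Q w)) ⟨
      sumⱽ (λ w → ∑[ q < 5 ] (m s w * δ (Q w) q))   ≡⟨ sumⱽ-∑-comm (λ q w → m s w * δ (Q w) q) ⟩
      ∑[ q < 5 ] sumⱽ (λ w → m s w * δ (Q w) q)     ≡⟨ sum-cong-≗ {5} (λ q → #₁ {x} Qx≡1 q s) ⟩
      ∑[ q < 5 ] (+ 5 * A + E * u₁ q s)             ≡⟨ ∑-affine (+ 5 * A) E (λ q → u₁ q s) ⟩
      + 5 * (+ 5 * A) + E * ∑[ q < 5 ] u₁ q s       ≡⟨ cong (λ v → + 5 * (+ 5 * A) + E * v) (table s) ⟩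
      + 5 * (+ 5 * A) + E * 0ℤ                      ≡⟨ collect A E ⟩
      + 25 * A                                      ∎
      where
      select : ∀ a (i : 𝔽) → ∑[ q < 5 ] (a * δ i q) ≡ a
      select a i = trans (sum-cong-≗ {5} λ q → ℤ.*-comm a (δ i q)) (∑-δ (λ _ → a) i)
      table : ∀ s → ∑[ q < 5 ] u₁ q s ≡ 0ℤ
      table = decide
      collect : ∀ A E → + 5 * (+ 5 * A) + E * 0ℤ ≡ + 25 * A
      collect = solve-∀

    -- The vector from `B-nondegenerate` is projected off x. Because z ⊥ x this keeps B u z = 1, and
    -- now translation along u also preserves the condition B w x = s.
    dual : ∃[ u ] (B u z ≡ 1F × B u x ≡ 0F)
    dual with u , Buz≡1 ← B-nondegenerate z z≢𝟎 = u ⊞ c u ⊡ x , Bu′z≡1 u Buz≡1 , Bu′x≡0 u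
      where
      c : Vec 𝔽 n → 𝔽
      c u = 4F ⊗ B u x
      keep : ∀ c → 1F ⊕ c ⊗ 0F ≡ 1F
      keep = decide
      cancel : ∀ b → b ⊕ (4F ⊗ b) ⊗ 1F ≡ 0F
      cancel = decide
      Bu′z≡1 : ∀ u → B u z ≡ 1F → B (u ⊞ c u ⊡ x) z ≡ 1F
      Bu′z≡1 u Buz≡1 = trans (B-translate (c u) u x z)
        (trans (cong₂ (λ p q → p ⊕ c u ⊗ q) Buz≡1 (trans (B-sym x z) z⊥x)) (keep (c u)))
      Bu′x≡0 : ∀ u → B (u ⊞ c u ⊡ x) x ≡ 0F
      Bu′x≡0 u = trans (B-translate (c u) u x x)
        (trans (cong (λ q → B u x ⊕ c u ⊗ q) Qx≡1) (cancel (B u x)))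

    -- Two equidistributions, first over the values of Q and then over those of B w z, each divide
    -- the 25 A vectors of the hyperplane by 5.
    #₂-isotropic-nonzero : Q z ≡ 0F → ∀ q s t → t ≢ 0F → # (m s) z q t ≡ A
    #₂-isotropic-nonzero Qz≡0 q s t t≢0 = ℤ.*-cancelˡ-≡ (+ 25) _ _ (begin
      + 25 * # (m s) z q t
        ≡⟨ ℤ.*-assoc (+ 5) (+ 5) (# (m s) z q t) ⟩
      + 5 * (+ 5 * # (m s) z q t)
        ≡⟨ cong (+ 5 *_) (#-isotropic (m s) z Qz≡0 (B-invariant z⊥x s) q t t≢0) ⟩
      + 5 * sumⱽ (λ w → m s w * δ (B w z) t)
        ≡⟨ linear-uniform (m s) z (proj₁ dual) (proj₁ (proj₂ dual)) (B-invariant (proj₂ (proj₂ dual)) s) t ⟩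
      sumⱽ (m s)
        ≡⟨ sum-m s ⟩
      + 25 * A ∎)

    -- Translation along z gives no information at t = 0, so that count is obtained by subtraction:
    -- the five counts add up to `#₁`, and the four others are A each.
    #₂-isotropic : Q z ≡ 0F → ∀ q s t → # (m s) z q t ≡ A + E * (δ t 0F * u₁ q s)
    #₂-isotropic Qz≡0 q s t with t ≟ 0F
    ... | no t≢0 = trans (#₂-isotropic-nonzero Qz≡0 q s t t≢0) (collect A E (u₁ q s))
      where
      collect : ∀ A E u → A ≡ A + E * (0ℤ * u)
      collect = solve-∀
    ... | yes refl = ∙-cancelʳ (+ 4 * A) _ _ (begin
      # (m s) z q 0F + + 4 * A
        ≡⟨ cong (λ v → # (m s) z q 0F + v) (four A) ⟩
      # (m s) z q 0F + (A + (A + (A + (A + 0ℤ))))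
        ≡⟨ cong (λ v → # (m s) z q 0F + v) (cong₂ _+_ (nonzero 1F λ ()) (cong₂ _+_ (nonzero 2F λ ())
             (cong₂ _+_ (nonzero 3F λ ()) (cong (_+ 0ℤ) (nonzero 4F λ ()))))) ⟨
      ∑[ t < 5 ] # (m s) z q t
        ≡⟨ ∑-# (m s) z q ⟩
      sumⱽ (λ w → m s w * δ (Q w) q)
        ≡⟨ #₁ {x} Qx≡1 q s ⟩
      + 5 * A + E * u₁ q s
        ≡⟨ collect A E (u₁ q s) ⟩
      A + E * (1ℤ * u₁ q s) + + 4 * A ∎)
      where
      nonzero : ∀ t → t ≢ 0F → # (m s) z q t ≡ A
      nonzero = #₂-isotropic-nonzero Qz≡0 q s
      four : ∀ A → + 4 * A ≡ A + (A + (A + (A + 0ℤ)))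
      four = solve-∀
      collect : ∀ A E u → + 5 * A + E * u ≡ A + E * (1ℤ * u) + + 4 * A
      collect = solve-∀

    #₂ : ∀ q s t → # (m s) z q t ≡ A + E * u₂ (Q z) q s t
    #₂ q s t = case Q z ≟ 0F of λ where
        (no Qz≢0)  → #₂-anisotropic Qz≢0 q s t
        (yes Qz≡0) → trans (#₂-isotropic Qz≡0 q s t) (cong (λ v → A + E * v) (trans (simplify q s t) (cong (λ r → u₂ r q s t) (sym Qz≡0))))
      where
      simplify : ∀ q s t → δ t 0F * u₁ q s ≡ u₂ 0F q s t
      simplify = decide

  pair-sum-⊥ : ∀ {x z : Vec 𝔽 n} → Q x ≡ 1F → B z x ≡ 0F → z ≢ 𝟎 → ∀ (p : 𝔽 → 𝔽 → ℤ) →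
    sumⱽ (λ w → δ (Q w) 1F * p (B w x) (B w z)) ≡
    A * (∑[ s < 5 ] ∑[ t < 5 ] p s t) + E * (∑[ s < 5 ] ∑[ t < 5 ] (p s t * u₂ (Q z) 1F s t))
  pair-sum-⊥ {x} {z} Qx≡1 z⊥x z≢𝟎 p = begin
    sumⱽ (λ w → δ (Q w) 1F * p (B w x) (B w z))
      ≡⟨ sumⱽ-cong expand ⟩
    sumⱽ (λ w → ∑[ s < 5 ] ∑[ t < 5 ] (p s t * term s t w))
      ≡⟨ sumⱽ-∑-comm (λ s w → ∑[ t < 5 ] (p s t * term s t w)) ⟩
    ∑[ s < 5 ] sumⱽ (λ w → ∑[ t < 5 ] (p s t * term s t w))
      ≡⟨ sum-cong-≗ {5} (λ s → sumⱽ-∑-comm (λ t w → p s t * term s t w)) ⟩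
    ∑[ s < 5 ] ∑[ t < 5 ] sumⱽ (λ w → p s t * term s t w)
      ≡⟨ sum-cong-≗ {5} (λ s → sum-cong-≗ {5} λ t →
           trans (sym (*-distribˡ-sumⱽ (p s t) (term s t)))
                 (cong (p s t *_) (#₂ Qx≡1 z⊥x z≢𝟎 1F s t))) ⟩
    ∑[ s < 5 ] ∑[ t < 5 ] (p s t * (A + E * u₂ (Q z) 1F s t))
      ≡⟨ ∑∑-weighted A E p (u₂ (Q z) 1F) ⟩
    A * (∑[ s < 5 ] ∑[ t < 5 ] p s t) + E * (∑[ s < 5 ] ∑[ t < 5 ] (p s t * u₂ (Q z) 1F s t)) ∎
    where
    term : 𝔽 → 𝔽 → Vec 𝔽 n → ℤ
    term s t w = δ (B w x) s * (δ (Q w) 1F * δ (B w z) t)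
    rearrange : ∀ a b c d → a * (b * (c * d)) ≡ b * (d * (c * a))
    rearrange = solve-∀
    expand : ∀ w → δ (Q w) 1F * p (B w x) (B w z) ≡ ∑[ s < 5 ] ∑[ t < 5 ] (p s t * term s t w)
    expand w = sym (begin
      ∑[ s < 5 ] ∑[ t < 5 ] (p s t * term s t w)
        ≡⟨ sum-cong-≗ {5} (λ s → trans
             (sum-cong-≗ {5} λ t → rearrange (p s t) (δ (B w x) s) (δ (Q w) 1F) (δ (B w z) t))
             (trans (sym (*-distribˡ-sum (δ (B w x) s) (λ t → δ (B w z) t * (δ (Q w) 1F * p s t))))
                    (cong (δ (B w x) s *_) (∑-δ (λ t → δ (Q w) 1F * p s t) (B w z))))) ⟩
      ∑[ s < 5 ] (δ (B w x) s * (δ (Q w) 1F * p s (B w z)))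
        ≡⟨ ∑-δ (λ s → δ (Q w) 1F * p s (B w z)) (B w x) ⟩
      δ (Q w) 1F * p (B w x) (B w z) ∎)

  module _ {x y : Vec 𝔽 n} (Qx≡1 : Q x ≡ 1F) where

    residue : Vec 𝔽 n
    residue = y ⊞ (4F ⊗ B y x) ⊡ x

    residue-⊥ : B residue x ≡ 0F
    residue-⊥ = trans (B-translate (4F ⊗ B y x) y x x)
      (trans (cong (λ q → B y x ⊕ (4F ⊗ B y x) ⊗ q) Qx≡1) (cancel (B y x)))
      where
      cancel : ∀ c → c ⊕ (4F ⊗ c) ⊗ 1F ≡ 0F
      cancel = decide

    B-residue : ∀ w → B w residue ⊕ B y x ⊗ B w x ≡ B w y
    B-residue w = begin
      B w residue ⊕ c ⊗ B w x                 ≡⟨ cong₂ (λ p q → p ⊕ c ⊗ q) (B-sym w residue) (B-sym w x) ⟩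
      B residue w ⊕ c ⊗ B x w                 ≡⟨ cong (_⊕ c ⊗ B x w) (B-translate (4F ⊗ c) y x w) ⟩
      (B y w ⊕ (4F ⊗ c) ⊗ B x w) ⊕ c ⊗ B x w  ≡⟨ cancel (B y w) c (B x w) ⟩
      B y w                                   ≡⟨ B-sym y w ⟩
      B w y                                   ∎
      where
      c = B y x
      cancel : ∀ p c q → (p ⊕ (4F ⊗ c) ⊗ q) ⊕ c ⊗ q ≡ p
      cancel = decide

    module _ (Qy≡1 : Q y ≡ 1F) where

      Q-residue : Q residue ≡ 1F ⊝ B y x ⊗ B y x
      Q-residue = trans (Q-translate (4F ⊗ B y x) y x)
        (trans (cong₂ (λ p q → (p ⊕ (4F ⊗ B y x) ⊗ (2F ⊗ B y x)) ⊕ ((4F ⊗ B y x) ⊗ (4F ⊗ B y x)) ⊗ q) Qy≡1 Qx≡1)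
               (simplify (B y x)))
        where
        simplify : ∀ c → (1F ⊕ (4F ⊗ c) ⊗ (2F ⊗ c)) ⊕ ((4F ⊗ c) ⊗ (4F ⊗ c)) ⊗ 1F ≡ 1F ⊝ c ⊗ c
        simplify = decide

      -- If the residue vanished, then y = c x with c² = 1, that is, y = x or y = -x.
      residue≢𝟎 : y ≢ x → y ≢ 4F ⊡ x → residue ≢ 𝟎
      residue≢𝟎 y≢x y≢-x z≡𝟎 = ±1 (B y x) (⊞-negate⁻ (B y x) x y z≡𝟎)
        (trans (sym Q-residue) (trans (cong Q z≡𝟎) (B-𝟎ˡ {n} 𝟎)))
        where
        -- For c = 0, 2, 3 the equation 1 - c² = 0 is refuted by evaluation, so those clauses are
        -- absent.
        ±1 : ∀ c → y ≡ c ⊡ x → 1F ⊝ c ⊗ c ≡ 0F → ⊥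
        ±1 1F y≡x  _ = y≢x (trans y≡x (1⊡ x))
        ±1 4F y≡-x _ = y≢-x y≡-x

      -- The substitution t ↦ t + c s, with c = B y x, passes from the residue back to y, and Q of
      -- the residue is 1 - c². Both hypotheses therefore speak of 𝔽 alone and can be tabulated for
      -- a concrete ψ.
      pair-sum : y ≢ x → y ≢ 4F ⊡ x → ∀ (ψ : 𝔽 → 𝔽 → ℤ) (P : ℤ) (U : 𝔽 → ℤ) →
        (∀ c → ∑[ s < 5 ] ∑[ t < 5 ] ψ s (t ⊕ c ⊗ s) ≡ P) →
        (∀ c → ∑[ s < 5 ] ∑[ t < 5 ] (ψ s (t ⊕ c ⊗ s) * u₂ (1F ⊝ c ⊗ c) 1F s t) ≡ U c) →
        sumⱽ (λ w → δ (Q w) 1F * ψ (B w x) (B w y)) ≡ A * P + E * U (B y x)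
      pair-sum y≢x y≢-x ψ P U ψ-sum ψ-u₂-sum = subst₂
        (λ P U → sumⱽ (λ w → δ (Q w) 1F * ψ (B w x) (B w y)) ≡ A * P + E * U)
        (ψ-sum (B y x))
        (trans (cong (λ r → ∑[ s < 5 ] ∑[ t < 5 ] (ψ s (t ⊕ B y x ⊗ s) * u₂ r 1F s t)) Q-residue)
               (ψ-u₂-sum (B y x)))
        (trans (sumⱽ-cong λ w → cong (λ b → δ (Q w) 1F * ψ (B w x) b) (sym (B-residue w)))
               (pair-sum-⊥ Qx≡1 residue-⊥ (residue≢𝟎 y≢x y≢-x) λ s t → ψ s (t ⊕ B y x ⊗ s)))

  unit-sum : ∀ {x : Vec 𝔽 n} → Q x ≡ 1F → ∀ (φ : 𝔽 → ℤ) →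
    sumⱽ (λ w → δ (Q w) 1F * φ (B w x)) ≡
    + 5 * A * sum φ + E * ∑[ s < 5 ] (φ s * u₁ 1F s)
  unit-sum {x} Qx≡1 φ = begin
    sumⱽ (λ w → δ (Q w) 1F * φ (B w x))
      ≡⟨ sumⱽ-cong expand ⟩
    sumⱽ (λ w → ∑[ s < 5 ] (φ s * (δ (B w x) s * δ (Q w) 1F)))
      ≡⟨ sumⱽ-∑-comm (λ s w → φ s * (δ (B w x) s * δ (Q w) 1F)) ⟩
    ∑[ s < 5 ] sumⱽ (λ w → φ s * (δ (B w x) s * δ (Q w) 1F))
      ≡⟨ sum-cong-≗ {5} (λ s → trans
           (sym (*-distribˡ-sumⱽ (φ s) (λ w → δ (B w x) s * δ (Q w) 1F)))
           (cong (φ s *_) (#₁ {x} Qx≡1 1F s))) ⟩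
    ∑[ s < 5 ] (φ s * (+ 5 * A + E * u₁ 1F s))
      ≡⟨ ∑-weighted (+ 5 * A) E φ (u₁ 1F) ⟩
    + 5 * A * sum φ + E * ∑[ s < 5 ] (φ s * u₁ 1F s) ∎
    where
    rearrange : ∀ a b c → a * (b * c) ≡ b * (c * a)
    rearrange = solve-∀
    expand : ∀ w → δ (Q w) 1F * φ (B w x) ≡ ∑[ s < 5 ] (φ s * (δ (B w x) s * δ (Q w) 1F))
    expand w = sym (trans
      (sum-cong-≗ {5} λ s → rearrange (φ s) (δ (B w x) s) (δ (Q w) 1F))
      (∑-δ (λ s → δ (Q w) 1F * φ s) (B w x)))

-- The tables of character sums

-- Vertices are vectors up to sign, so only squares of values of B are meaningful: k = 0 encodes
-- orthogonality, k = 4 adjacency.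
φ : 𝔽 → 𝔽 → ℤ
φ k s = δ (s ⊗ s) k

φ₀-sum : ∀ c → ∑[ s < 5 ] ∑[ t < 5 ] (φ 0F s * φ 0F (t ⊕ c ⊗ s)) ≡ + 1
φ₀-sum = decide

φ₄-sum : ∀ c → ∑[ s < 5 ] ∑[ t < 5 ] (φ 4F s * φ 4F (t ⊕ c ⊗ s)) ≡ + 4
φ₄-sum = decide

φ₀-u₂-sum : ∀ c → ∑[ s < 5 ] ∑[ t < 5 ] (φ 0F s * φ 0F (t ⊕ c ⊗ s) * u₂ (1F ⊝ c ⊗ c) 1F s t) ≡ + 2 * φ 0F c - 1ℤ
φ₀-u₂-sum = decide

-- The source of the Deza property: the value is -4 for c = 0 and -2 for every other c, without
-- distinguishing c = ±1 from c = ±2.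
φ₄-u₂-sum : ∀ c → ∑[ s < 5 ] ∑[ t < 5 ] (φ 4F s * φ 4F (t ⊕ c ⊗ s) * u₂ (1F ⊝ c ⊗ c) 1F s t) ≡ - + 2 - + 2 * φ 0F c
φ₄-u₂-sum = decide

-- Sums over finite sets

∑-distrib-- : ∀ {n} (f g : Fin n → ℤ) → ∑[ i < n ] (f i - g i) ≡ sum f - sum g
∑-distrib-- {zero}  f g = refl
∑-distrib-- {suc n} f g = trans (cong (λ s → f 0F - g 0F + s) (∑-distrib-- (f ∘ Fin.suc) (g ∘ Fin.suc)))
  (interchange (f 0F) (g 0F) (sum (f ∘ Fin.suc)) (sum (g ∘ Fin.suc)))
  where
  interchange : ∀ a b c d → a - b + (c - d) ≡ a + c - (b + d)
  interchange = solve-∀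

∑-1 : ∀ n → ∑[ i < n ] 1ℤ ≡ + n
∑-1 zero    = refl
∑-1 (suc n) = cong (λ s → 1ℤ + s) (∑-1 n)

∑-δ-1 : ∀ {n} (i : Fin n) → sum (δ i) ≡ 1ℤ
∑-δ-1 i = trans (sum-cong-≗ λ j → sym (ℤ.*-identityʳ (δ i j))) (∑-δ (λ _ → 1ℤ) i)

⟦⟧-true : ∀ {a} {A : Set a} (A? : Dec A) → A → ⟦ does A? ⟧ ≡ 1ℤ
⟦⟧-true A? a = cong ⟦_⟧ (dec-true A? a)

⟦⟧-false : ∀ {a} {A : Set a} (A? : Dec A) → ¬ A → ⟦ does A? ⟧ ≡ 0ℤ
⟦⟧-false A? ¬a = cong ⟦_⟧ (dec-false A? ¬a)

⟦⟧-∧ : ∀ a b → ⟦ a ∧ b ⟧ ≡ ⟦ a ⟧ * ⟦ b ⟧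
⟦⟧-∧ true  b = sym (ℤ.*-identityˡ ⟦ b ⟧)
⟦⟧-∧ false b = refl

∑-complement : ∀ {n} (u : Fin n) f → ∑[ i < n ] ((1ℤ - δ u i) - f i) ≡ + n - 1ℤ - sum f
∑-complement {n} u f = begin
  ∑[ i < n ] ((1ℤ - δ u i) - f i)     ≡⟨ ∑-distrib-- (λ i → 1ℤ - δ u i) f ⟩
  ∑[ i < n ] (1ℤ - δ u i) - sum f     ≡⟨ cong (_- sum f) (∑-distrib-- (λ _ → 1ℤ) (δ u)) ⟩
  ∑[ i < n ] 1ℤ - sum (δ u) - sum f   ≡⟨ cong₂ (λ a b → a - b - sum f) (∑-1 n) (∑-δ-1 u) ⟩
  + n - 1ℤ - sum f                    ∎

-- Inclusion and exclusion for common neighbours in a complement, `f` and `g` being the adjacency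
-- rows of u and v. The terms `f v` and `g u` come from the diagonal deltas.
∑-complement₂ : ∀ {n} {u v : Fin n} → u ≢ v → ∀ f g →
  ∑[ i < n ] (((1ℤ - δ u i) - f i) * ((1ℤ - δ v i) - g i)) ≡
  + n - + 2 - sum f - sum g + f v + g u + ∑[ i < n ] (f i * g i)
∑-complement₂ {n} {u} {v} u≢v f g = begin
  ∑[ i < n ] (((1ℤ - δ u i) - f i) * ((1ℤ - δ v i) - g i))
    ≡⟨ sum-cong-≗ (λ i → expand (δ u i) (δ v i) (f i) (g i)) ⟩
  ∑[ i < n ] (((1ℤ - δ u i) - f i) - ((δ v i + g i) - f′ i))
    ≡⟨ ∑-distrib-- (λ i → (1ℤ - δ u i) - f i) (λ i → (δ v i + g i) - f′ i) ⟩
  ∑[ i < n ] ((1ℤ - δ u i) - f i) - ∑[ i < n ] ((δ v i + g i) - f′ i)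
    ≡⟨ cong₂ _-_ (∑-complement u f) (∑-distrib-- (λ i → δ v i + g i) f′) ⟩
  + n - 1ℤ - sum f - (∑[ i < n ] (δ v i + g i) - sum f′)
    ≡⟨ cong₂ (λ a b → + n - 1ℤ - sum f - (a - b)) (∑-distrib-+ (δ v) g)
         (trans (∑-distrib-+ (λ i → δ u i * (δ v i + g i) + δ v i * f i) (λ i → f i * g i))
           (cong (_+ ∑[ i < n ] (f i * g i)) (trans
             (∑-distrib-+ (λ i → δ u i * (δ v i + g i)) (λ i → δ v i * f i))
             (cong₂ _+_ (∑-δ (λ i → δ v i + g i) u) (∑-δ f v))))) ⟩
  + n - 1ℤ - sum f - (sum (δ v) + sum g - ((δ v u + g u) + f v + ∑[ i < n ] (f i * g i)))
    ≡⟨ cong₂ (λ a b → + n - 1ℤ - sum f - (a + sum g - ((b + g u) + f v + ∑[ i < n ] (f i * g i))))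
         (∑-δ-1 v) (⟦⟧-false (v ≟ u) (u≢v ∘ sym)) ⟩
  + n - 1ℤ - sum f - (1ℤ + sum g - ((0ℤ + g u) + f v + ∑[ i < n ] (f i * g i)))
    ≡⟨ collect (+ n) (sum f) (sum g) (g u) (f v) (∑[ i < n ] (f i * g i)) ⟩
  + n - + 2 - sum f - sum g + f v + g u + ∑[ i < n ] (f i * g i) ∎
  where
  f′ : Fin n → ℤ
  f′ i = δ u i * (δ v i + g i) + δ v i * f i + f i * g i
  expand : ∀ a b x y → ((1ℤ - a) - x) * ((1ℤ - b) - y) ≡ ((1ℤ - a) - x) - ((b + y) - (a * (b + y) + b * x + x * y))
  expand = solve-∀
  collect : ∀ m F G a b H → m - 1ℤ - F - (1ℤ + G - ((0ℤ + a) + b + H)) ≡ m - + 2 - F - G + b + a + H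
  collect = solve-∀

∣tabulate∣ : ∀ {n} (p : Fin n → Bool) → + ∣ tabulate p ∣ ≡ ∑[ i < n ] ⟦ p i ⟧
∣tabulate∣ {zero}  p = refl
∣tabulate∣ {suc n} p with p 0F
... | true  = cong (λ s → 1ℤ + s) (∣tabulate∣ (p ∘ Fin.suc))
... | false = trans (∣tabulate∣ (p ∘ Fin.suc)) (sym (ℤ.+-identityˡ _))

tabulate-∩ : ∀ {n} (p q : Fin n → Bool) → tabulate p ∩ tabulate q ≡ tabulate λ i → p i ∧ q i
tabulate-∩ {zero}  p q = refl
tabulate-∩ {suc n} p q = cong (p 0F ∧ q 0F ∷_) (tabulate-∩ (p ∘ Fin.suc) (q ∘ Fin.suc))

adj : ∀ {n} (G : Graph n) → Fin n → Fin n → ℤ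
adj G u i = ⟦ does (adj? G u i) ⟧

degree-∑ : ∀ {n} (G : Graph n) u → + degree G u ≡ sum (adj G u)
degree-∑ G u = ∣tabulate∣ λ i → does (adj? G u i)

commonNeighbours-∑ : ∀ {n} (G : Graph n) u v →
  + commonNeighbours G u v ≡ ∑[ i < n ] (adj G u i * adj G v i)
commonNeighbours-∑ G u v = begin
  + commonNeighbours G u v                        ≡⟨ cong (λ s → + ∣ s ∣) (tabulate-∩ p q) ⟩
  + ∣ (tabulate λ i → p i ∧ q i) ∣                ≡⟨ ∣tabulate∣ (λ i → p i ∧ q i) ⟩
  sum (λ i → ⟦ p i ∧ q i ⟧)                       ≡⟨ sum-cong-≗ (λ i → ⟦⟧-∧ (p i) (q i)) ⟩
  sum (λ i → adj G u i * adj G v i)               ∎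
  where
  p = λ i → does (adj? G u i)
  q = λ i → does (adj? G v i)

-- Sums over lists and the enumeration of all vectors

module _ {a} {X : Set a} where

  -- The bridge between sums over vertices, which are indices into a filtered list, and `sumⱽ`.
  ∑ᴸ : (X → ℤ) → List X → ℤ
  ∑ᴸ f []       = 0ℤ
  ∑ᴸ f (x ∷ xs) = f x + ∑ᴸ f xs

  ∑-lookup : ∀ f xs → ∑[ i < length xs ] f (lookup xs i) ≡ ∑ᴸ f xs
  ∑-lookup f []       = refl
  ∑-lookup f (x ∷ xs) = cong (λ s → f x + s) (∑-lookup f xs)

  ∑ᴸ-++ : ∀ f xs ys → ∑ᴸ f (xs ++ ys) ≡ ∑ᴸ f xs + ∑ᴸ f ys
  ∑ᴸ-++ f []       ys = sym (ℤ.+-identityˡ _)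
  ∑ᴸ-++ f (x ∷ xs) ys = trans (cong (λ s → f x + s) (∑ᴸ-++ f xs ys)) (sym (ℤ.+-assoc (f x) _ _))

  ∑ᴸ-filter : ∀ {p} {P : X → Set p} (P? : ∀ x → Dec (P x)) f xs →
    ∑ᴸ f (filter P? xs) ≡ ∑ᴸ (λ x → ⟦ does (P? x) ⟧ * f x) xs
  ∑ᴸ-filter P? f []       = refl
  ∑ᴸ-filter P? f (x ∷ xs) with does (P? x)
  ... | true  = cong₂ _+_ (sym (ℤ.*-identityˡ (f x))) (∑ᴸ-filter P? f xs)
  ... | false = trans (∑ᴸ-filter P? f xs) (sym (ℤ.+-identityˡ _))

  lookup-injective : ∀ {xs : List X} → Unique xs → ∀ i j → lookup xs i ≡ lookup xs j → i ≡ j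
  lookup-injective (x∉xs ∷ _) 0F          0F          _  = refl
  lookup-injective (x∉xs ∷ _) 0F          (Fin.suc j) eq = contradiction eq (All.lookup x∉xs (∈-lookup j))
  lookup-injective (x∉xs ∷ _) (Fin.suc i) 0F          eq = contradiction (sym eq) (All.lookup x∉xs (∈-lookup i))
  lookup-injective (_ ∷ xs!)  (Fin.suc i) (Fin.suc j) eq = cong Fin.suc (lookup-injective xs! i j eq)

∑ᴸ-map : ∀ {a b} {X : Set a} {Y : Set b} (f : Y → ℤ) (g : X → Y) xs → ∑ᴸ f (List.map g xs) ≡ ∑ᴸ (f ∘ g) xs
∑ᴸ-map f g []       = refl
∑ᴸ-map f g (x ∷ xs) = cong (λ s → f (g x) + s) (∑ᴸ-map f g xs)

vectors : ∀ n → List (Vec 𝔽 n)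
vectors zero    = [] ∷ []
vectors (suc n) = cartesianProductWith _∷_ (allFin 5) (vectors n)

vectors-unique : ∀ n → Unique (vectors n)
vectors-unique zero    = [] ∷ []
vectors-unique (suc n) = cartesianProductWith⁺ _∷_ ∷-injective (allFin⁺ 5) (vectors-unique n)

opaque
  unfolding sumⱽ

  ∑ᴸ-vectors : ∀ {n} (f : Vec 𝔽 n → ℤ) → ∑ᴸ f (vectors n) ≡ sumⱽ f
  ∑ᴸ-vectors {zero}  f = ℤ.+-identityʳ (f [])
  ∑ᴸ-vectors {suc n} f = block 0F (block 1F (block 2F (block 3F (block 4F refl))))
    where
    block : ∀ a {ws s} → ∑ᴸ f ws ≡ s → ∑ᴸ f (List.map (a ∷_) (vectors n) ++ ws) ≡ sumⱽ (λ w → f (a ∷ w)) + s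
    block a {ws} eq = trans (∑ᴸ-++ f (List.map (a ∷_) (vectors n)) ws)
      (cong₂ _+_ (trans (∑ᴸ-map f (a ∷_) (vectors n)) (∑ᴸ-vectors (λ w → f (a ∷ w)))) eq)

-- Exactly one of w and -w is positive, unless w = 0.
positive : ∀ {n} → Vec 𝔽 n → Bool
positive []       = false
positive (0F ∷ w) = positive w
positive (1F ∷ w) = true
positive (2F ∷ w) = true
positive (3F ∷ w) = false
positive (4F ∷ w) = false

positive-negate : ∀ {n} (w : Vec 𝔽 n) → ⟦ positive w ⟧ + ⟦ positive (4F ⊡ w) ⟧ ≡ 1ℤ ⊎ w ≡ 𝟎
positive-negate []       = inj₂ refl
positive-negate (0F ∷ w) with positive-negate w
... | inj₁ eq   = inj₁ eq
... | inj₂ refl = inj₂ refl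
positive-negate (1F ∷ w) = inj₁ refl
positive-negate (2F ∷ w) = inj₁ refl
positive-negate (3F ∷ w) = inj₁ refl
positive-negate (4F ∷ w) = inj₁ refl

positive-antisym : ∀ {n} (w : Vec 𝔽 n) → positive w ≡ true → positive (4F ⊡ w) ≢ true
positive-antisym (0F ∷ w) p = positive-antisym w p
positive-antisym (1F ∷ w) p ()
positive-antisym (2F ∷ w) p ()
positive-antisym (3F ∷ w) ()
positive-antisym (4F ∷ w) ()

-- The vectors w and -w contribute equally and exactly one of them is positive. The zero vector has
-- no partner, hence the condition on `f 𝟎`.
sumⱽ-even : ∀ {n} (f : Vec 𝔽 n → ℤ) → (∀ w → f (4F ⊡ w) ≡ f w) → f 𝟎 ≡ 0ℤ →
  + 2 * sumⱽ (λ w → ⟦ positive w ⟧ * f w) ≡ sumⱽ f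
sumⱽ-even {n} f even f𝟎≡0 = begin
  + 2 * S
    ≡⟨ double S ⟩
  S + S
    ≡⟨ cong (λ s → S + s) (sumⱽ-negate (λ w → ⟦ positive w ⟧ * f w)) ⟩
  S + sumⱽ (λ w → ⟦ positive (4F ⊡ w) ⟧ * f (4F ⊡ w))
    ≡⟨ sumⱽ-distrib-+ (λ w → ⟦ positive w ⟧ * f w) (λ w → ⟦ positive (4F ⊡ w) ⟧ * f (4F ⊡ w)) ⟨
  sumⱽ (λ w → ⟦ positive w ⟧ * f w + ⟦ positive (4F ⊡ w) ⟧ * f (4F ⊡ w))
    ≡⟨ sumⱽ-cong split ⟩
  sumⱽ f ∎
  where
  S = sumⱽ (λ w → ⟦ positive w ⟧ * f w)
  double : ∀ s → + 2 * s ≡ s + s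
  double = solve-∀
  split : ∀ w → ⟦ positive w ⟧ * f w + ⟦ positive (4F ⊡ w) ⟧ * f (4F ⊡ w) ≡ f w
  split w = begin
    ⟦ positive w ⟧ * f w + ⟦ positive (4F ⊡ w) ⟧ * f (4F ⊡ w)
      ≡⟨ cong (λ v → ⟦ positive w ⟧ * f w + ⟦ positive (4F ⊡ w) ⟧ * v) (even w) ⟩
    ⟦ positive w ⟧ * f w + ⟦ positive (4F ⊡ w) ⟧ * f w
      ≡⟨ ℤ.*-distribʳ-+ (f w) ⟦ positive w ⟧ ⟦ positive (4F ⊡ w) ⟧ ⟨
    (⟦ positive w ⟧ + ⟦ positive (4F ⊡ w) ⟧) * f w
      ≡⟨ one w (positive-negate w) ⟩
    f w ∎
    where
    one : ∀ w → ⟦ positive w ⟧ + ⟦ positive (4F ⊡ w) ⟧ ≡ 1ℤ ⊎ w ≡ 𝟎 →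
      (⟦ positive w ⟧ + ⟦ positive (4F ⊡ w) ⟧) * f w ≡ f w
    one w (inj₁ eq)   = trans (cong (_* f w) eq) (ℤ.*-identityˡ (f w))
    one w (inj₂ refl) = trans (cong (c *_) f𝟎≡0) (trans (ℤ.*-zeroʳ c) (sym f𝟎≡0))
      where c = ⟦ positive w ⟧ + ⟦ positive (4F ⊡ w) ⟧

-- The graph and its children

-- Counts of vertices come out doubled, whereas `/ℕ` rounds down. Since x is itself an integer, y is
-- even and the division is exact.
halve : ∀ {x y : ℤ} {c : ℕ} → + c ≡ x → + 2 * x ≡ y → x ≡ y /ℕ 2
halve {c = c} refl refl = begin
  + c                  ≡⟨ cong +_ (m*n/n≡m c 2) ⟨
  + (c ℕ.* 2 ℕ./ 2)    ≡⟨ cong (_/ℕ 2) (trans (ℤ.pos-* c 2) (ℤ.*-comm (+ c) (+ 2))) ⟩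
  (+ 2 * + c) /ℕ 2     ∎

module DezaGraph (d : 𝔽) (d≢0 : d ≢ 0F) (n : ℕ) (A E : ℤ) (E≢0 : E ≢ 0ℤ)
  (#Q≡ : ∀ q → Form.#Q d d≢0 n q ≡ + 25 * A + (+ 5 * E) * χ q) where

  open Form d d≢0
  open Counts d d≢0 n A E #Q≡

  vertex? : ∀ (w : Vec 𝔽 n) → Dec (positive w ≡ true × Q w ≡ 1F)
  vertex? w = (positive w Bool.≟ true) ×-dec (Q w ≟ 1F)

  V : List (Vec 𝔽 n)
  V = filter vertex? (vectors n)

  v : ℕ
  v = length V

  vert : Fin v → Vec 𝔽 n
  vert = lookup V

  vert-vertex : ∀ i → positive (vert i) ≡ true × Q (vert i) ≡ 1F
  vert-vertex i = All.lookup (all-filter vertex? (vectors n)) (∈-lookup i)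

  vert-injective : ∀ i j → vert i ≡ vert j → i ≡ j
  vert-injective = lookup-injective (filter⁺ vertex? (vectors-unique n))

  vert≢-vert : ∀ i j → vert i ≢ 4F ⊡ vert j
  vert≢-vert i j eq = positive-antisym (vert j) (proj₁ (vert-vertex j))
    (trans (sym (cong positive eq)) (proj₁ (vert-vertex i)))

  ∑-vert : ∀ (f : Vec 𝔽 n → ℤ) → (∀ w → f (4F ⊡ w) ≡ f w) →
    + 2 * ∑[ i < v ] f (vert i) ≡ sumⱽ (λ w → δ (Q w) 1F * f w)
  ∑-vert f even = begin
    + 2 * ∑[ i < v ] f (vert i)
      ≡⟨ cong (+ 2 *_) (trans (∑-lookup f V) (∑ᴸ-filter vertex? f (vectors n))) ⟩
    + 2 * ∑ᴸ (λ w → ⟦ does (vertex? w) ⟧ * f w) (vectors n)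
      ≡⟨ cong (+ 2 *_) (trans (∑ᴸ-vectors (λ w → ⟦ does (vertex? w) ⟧ * f w)) (sumⱽ-cong split)) ⟩
    + 2 * sumⱽ (λ w → ⟦ positive w ⟧ * (δ (Q w) 1F * f w))
      ≡⟨ sumⱽ-even (λ w → δ (Q w) 1F * f w) (λ w → cong₂ _*_ (cong (λ q → δ q 1F) (Q-negate w)) (even w))
           -- Q 𝟎 = 0 differs from 1, so the zero vector contributes nothing.
           (cong (λ q → δ q 1F * f 𝟎) (B-𝟎ˡ {n} 𝟎)) ⟩
    sumⱽ (λ w → δ (Q w) 1F * f w) ∎
    where
    does-≟-true : ∀ b → does (b Bool.≟ true) ≡ b
    does-≟-true true  = refl
    does-≟-true false = refl
    split : ∀ w → ⟦ does (vertex? w) ⟧ * f w ≡ ⟦ positive w ⟧ * (δ (Q w) 1F * f w)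
    split w = trans (cong (_* f w) (trans (⟦⟧-∧ (does (positive w Bool.≟ true)) (does (Q w ≟ 1F)))
                                          (cong (λ b → ⟦ b ⟧ * δ (Q w) 1F) (does-≟-true (positive w)))))
                    (ℤ.*-assoc ⟦ positive w ⟧ (δ (Q w) 1F) (f w))
    Q-negate : ∀ w → Q (4F ⊡ w) ≡ Q w
    Q-negate w = begin
      B (4F ⊡ w) (4F ⊡ w)    ≡⟨ B-⊡ˡ 4F w (4F ⊡ w) ⟩
      4F ⊗ B w (4F ⊡ w)      ≡⟨ cong (4F ⊗_) (B-sym w (4F ⊡ w)) ⟩
      4F ⊗ B (4F ⊡ w) w      ≡⟨ cong (4F ⊗_) (B-⊡ˡ 4F w w) ⟩
      4F ⊗ (4F ⊗ Q w)        ≡⟨ negate-involutive (Q w) ⟩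
      Q w                    ∎

  -- Squaring makes the value independent of which of w and -w represents a vertex.
  B² : Fin v → Fin v → 𝔽
  B² i j = B (vert i) (vert j) ⊗ B (vert i) (vert j)

  B²-sym : ∀ i j → B² i j ≡ B² j i
  B²-sym i j = cong (λ b → b ⊗ b) (B-sym (vert i) (vert j))

  B²-refl : ∀ i → B² i i ≡ 1F
  B²-refl i = cong (λ b → b ⊗ b) (proj₂ (vert-vertex i))

  rel : 𝔽 → Fin v → Fin v → ℤ
  rel k i j = δ (B² i j) k

  φ-even : ∀ k (x w : Vec 𝔽 n) → φ k (B (4F ⊡ w) x) ≡ φ k (B w x)
  φ-even k x w = trans (cong (φ k) (B-⊡ˡ 4F w x)) (even k (B w x))
    where
    even : ∀ k b → φ k (4F ⊗ b) ≡ φ k b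
    even = decide

  order : + 2 * + v ≡ + 25 * A + + 5 * E
  order = begin
    + 2 * + v                        ≡⟨ cong (+ 2 *_) (∑-1 v) ⟨
    + 2 * ∑[ i < v ] 1ℤ              ≡⟨ ∑-vert (λ _ → 1ℤ) (λ _ → refl) ⟩
    sumⱽ (λ w → δ (Q w) 1F * 1ℤ)     ≡⟨ sumⱽ-cong (λ w → ℤ.*-identityʳ (δ (Q w) 1F)) ⟩
    #Q n 1F                          ≡⟨ #Q≡ 1F ⟩
    + 25 * A + (+ 5 * E) * 1ℤ        ≡⟨ cong (λ s → + 25 * A + s) (ℤ.*-identityʳ (+ 5 * E)) ⟩
    + 25 * A + + 5 * E               ∎

  rel-sum : ∀ k u → + 2 * sum (rel k u) ≡ + 5 * A * sum (φ k) + E * ∑[ s < 5 ] (φ k s * u₁ 1F s)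
  rel-sum k u = begin
    + 2 * sum (rel k u)
      ≡⟨ cong (+ 2 *_) (sum-cong-≗ λ i → cong (λ b → δ b k) (B²-sym u i)) ⟩
    + 2 * ∑[ i < v ] φ k (B (vert i) (vert u))
      ≡⟨ ∑-vert (λ w → φ k (B w (vert u))) (φ-even k (vert u)) ⟩
    sumⱽ (λ w → δ (Q w) 1F * φ k (B w (vert u)))
      ≡⟨ unit-sum (proj₂ (vert-vertex u)) (φ k) ⟩
    + 5 * A * sum (φ k) + E * ∑[ s < 5 ] (φ k s * u₁ 1F s) ∎

  rel-pair-sum : ∀ k {u w} → u ≢ w → ∀ (P : ℤ) (U : 𝔽 → ℤ) →
    (∀ c → ∑[ s < 5 ] ∑[ t < 5 ] (φ k s * φ k (t ⊕ c ⊗ s)) ≡ P) →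
    (∀ c → ∑[ s < 5 ] ∑[ t < 5 ] (φ k s * φ k (t ⊕ c ⊗ s) * u₂ (1F ⊝ c ⊗ c) 1F s t) ≡ U c) →
    + 2 * ∑[ i < v ] (rel k u i * rel k w i) ≡ A * P + E * U (B (vert w) (vert u))
  rel-pair-sum k {u} {w} u≢w P U φ-sum φ-u₂-sum = begin
    + 2 * ∑[ i < v ] (rel k u i * rel k w i)
      ≡⟨ cong (+ 2 *_) (sum-cong-≗ λ i → cong₂ (λ b c → δ b k * δ c k) (B²-sym u i) (B²-sym w i)) ⟩
    + 2 * ∑[ i < v ] (φ k (B (vert i) (vert u)) * φ k (B (vert i) (vert w)))
      ≡⟨ ∑-vert (λ x → φ k (B x (vert u)) * φ k (B x (vert w)))
           (λ x → cong₂ _*_ (φ-even k (vert u) x) (φ-even k (vert w) x)) ⟩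
    sumⱽ (λ x → δ (Q x) 1F * (φ k (B x (vert u)) * φ k (B x (vert w))))
      ≡⟨ pair-sum (proj₂ (vert-vertex u)) (proj₂ (vert-vertex w))
           (λ eq → u≢w (vert-injective u w (sym eq))) (vert≢-vert w u)
           (λ s t → φ k s * φ k t) P U φ-sum φ-u₂-sum ⟩
    A * P + E * U (B (vert w) (vert u)) ∎

  G : Graph v
  G = record
    { Adj       = λ i j → B² i j ≡ 4F
    ; adj?      = λ i j → B² i j ≟ 4F
    ; symmetric = λ {i} {j} → trans (B²-sym j i)
    ; loopless  = λ i B²≡4 → contradiction (trans (sym (B²-refl i)) B²≡4) λ ()
    }

  a b : ℤ
  a = + 2 * A - E
  b = + 2 * (A - E)

  halves : ∀ {x y} → + 2 * x ≡ + 2 * y → x ≡ y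
  halves {x} {y} = ℤ.*-cancelˡ-≡ (+ 2) x y

  regular : ∀ u → + degree G u ≡ + 5 * A - E
  regular u = halves (begin
    + 2 * + degree G u        ≡⟨ cong (+ 2 *_) (degree-∑ G u) ⟩
    + 2 * sum (rel 4F u)      ≡⟨ rel-sum 4F u ⟩
    + 5 * A * + 2 + E * - + 2 ≡⟨ collect A E ⟩
    + 2 * (+ 5 * A - E)       ∎)
    where
    collect : ∀ A E → + 5 * A * + 2 + E * - + 2 ≡ + 2 * (+ 5 * A - E)
    collect = solve-∀

  common : ∀ {u w} → u ≢ w → + commonNeighbours G u w ≡ a - E * rel 0F u w
  common {u} {w} u≢w = halves (begin
    + 2 * + commonNeighbours G u w
      ≡⟨ cong (+ 2 *_) (commonNeighbours-∑ G u w) ⟩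
    + 2 * ∑[ i < v ] (rel 4F u i * rel 4F w i)
      ≡⟨ rel-pair-sum 4F u≢w (+ 4) (λ c → - + 2 - + 2 * φ 0F c) φ₄-sum φ₄-u₂-sum ⟩
    A * + 4 + E * (- + 2 - + 2 * rel 0F w u)
      ≡⟨ collect A E (rel 0F w u) ⟩
    + 2 * (a - E * rel 0F w u)
      ≡⟨ cong (λ c → + 2 * (a - E * δ c 0F)) (B²-sym w u) ⟩
    + 2 * (a - E * rel 0F u w) ∎)
    where
    collect : ∀ A E r → A * + 4 + E * (- + 2 - + 2 * r) ≡ + 2 * (+ 2 * A - E - E * r)
    collect = solve-∀

  common-orthogonal : ∀ {u w} → u ≢ w → B² u w ≡ 0F → + commonNeighbours G u w ≡ b
  common-orthogonal {u} {w} u≢w ⊥ = begin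
    + commonNeighbours G u w   ≡⟨ common u≢w ⟩
    a - E * rel 0F u w         ≡⟨ cong (λ r → a - E * r) (⟦⟧-true (B² u w ≟ 0F) ⊥) ⟩
    a - E * 1ℤ                 ≡⟨ collect A E ⟩
    b                          ∎
    where
    collect : ∀ A E → + 2 * A - E - E * 1ℤ ≡ + 2 * (A - E)
    collect = solve-∀

  common-nonorthogonal : ∀ {u w} → u ≢ w → B² u w ≢ 0F → + commonNeighbours G u w ≡ a
  common-nonorthogonal {u} {w} u≢w ⊥̸ = begin
    + commonNeighbours G u w   ≡⟨ common u≢w ⟩
    a - E * rel 0F u w         ≡⟨ cong (λ r → a - E * r) (⟦⟧-false (B² u w ≟ 0F) ⊥̸) ⟩
    a - E * 0ℤ                 ≡⟨ collect A E ⟩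
    a                          ∎
    where
    collect : ∀ A E → + 2 * A - E - E * 0ℤ ≡ + 2 * A - E
    collect = solve-∀

  a≢b : a ≢ b
  a≢b a≡b = E≢0 (begin
    E                       ≡⟨ difference A E ⟩
    a - b                   ≡⟨ cong (_- b) a≡b ⟩
    b - b                   ≡⟨ ℤ.+-inverseʳ b ⟩
    0ℤ                      ∎)
    where
    difference : ∀ A E → E ≡ + 2 * A - E - + 2 * (A - E)
    difference = solve-∀

  child-b⇒orthogonal : ∀ {u w} → Adj (child G b) u w → B² u w ≡ 0F
  child-b⇒orthogonal {u} {w} (u≢w , c≡b) = case B² u w ≟ 0F of λ where
    (yes ⊥) → ⊥
    (no ⊥̸)  → contradiction (trans (sym (common-nonorthogonal u≢w ⊥̸)) c≡b) a≢b

  orthogonal⇒≢ : ∀ {u w} → B² u w ≡ 0F → u ≢ w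
  orthogonal⇒≢ {u} ⊥ refl = contradiction (trans (sym (B²-refl u)) ⊥) λ ()

  orthogonal⇒child-b : ∀ {u w} → B² u w ≡ 0F → Adj (child G b) u w
  orthogonal⇒child-b ⊥ = orthogonal⇒≢ ⊥ , common-orthogonal (orthogonal⇒≢ ⊥) ⊥

  child-a⇒nonorthogonal : ∀ {u w} → Adj (child G a) u w → B² u w ≢ 0F
  child-a⇒nonorthogonal (u≢w , c≡a) ⊥ = a≢b (trans (sym c≡a) (common-orthogonal u≢w ⊥))

  adj-child-b : ∀ u w → adj (child G b) u w ≡ rel 0F u w
  adj-child-b u w = cong ⟦_⟧ (does-⇔ (mk⇔ child-b⇒orthogonal orthogonal⇒child-b)
    (adj? (child G b) u w) (B² u w ≟ 0F))

  -- The shape is the one consumed by `∑-complement` and `∑-complement₂`; this child is the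
  -- complement of orthogonality.
  adj-child-a : ∀ u w → adj (child G a) u w ≡ (1ℤ - δ u w) - rel 0F u w
  adj-child-a u w = case u ≟ w of λ where
    (yes refl) → trans (⟦⟧-false (adj? (child G a) u u) (loopless (child G a) u))
      (sym (cong₂ (λ x y → 1ℤ - x - y) (⟦⟧-true (u ≟ u) refl) (cong (λ q → δ q 0F) (B²-refl u))))
    (no u≢w) → case B² u w ≟ 0F of λ where
      (yes ⊥) → trans (⟦⟧-false (adj? (child G a) u w) (λ adj → child-a⇒nonorthogonal adj ⊥))
        (sym (cong₂ (λ x y → 1ℤ - x - y) (⟦⟧-false (u ≟ w) u≢w) (⟦⟧-true (B² u w ≟ 0F) ⊥)))
      (no ⊥̸) → trans (⟦⟧-true (adj? (child G a) u w) (u≢w , common-nonorthogonal u≢w ⊥̸))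
        (sym (cong₂ (λ x y → 1ℤ - x - y) (⟦⟧-false (u ≟ w) u≢w) (⟦⟧-false (B² u w ≟ 0F) ⊥̸)))

  order/2 : + v ≡ (+ 25 * A + + 5 * E) /ℕ 2
  order/2 = halve {c = v} refl order

  rel₀-sum : ∀ u → + 2 * sum (rel 0F u) ≡ + 5 * A - E
  rel₀-sum u = trans (rel-sum 0F u) (collect A E)
    where
    collect : ∀ A E → + 5 * A * 1ℤ + E * - 1ℤ ≡ + 5 * A - E
    collect = solve-∀

  rel₀-pair-sum : ∀ {u w} → u ≢ w →
    + 2 * ∑[ i < v ] (rel 0F u i * rel 0F w i) ≡ A + E * (+ 2 * rel 0F u w - 1ℤ)
  rel₀-pair-sum {u} {w} u≢w = trans
    (rel-pair-sum 0F u≢w 1ℤ (λ c → + 2 * φ 0F c - 1ℤ) φ₀-sum φ₀-u₂-sum)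
    (cong₂ (λ x r → x + E * (+ 2 * r - 1ℤ)) (ℤ.*-identityʳ A) (cong (λ q → δ q 0F) (B²-sym w u)))

  isDeza : IsDeza G ((+ 25 * A + + 5 * E) /ℕ 2) (+ 5 * A - E) b a
  isDeza = record
    { order   = order/2
    ; regular = regular
    ; common  = λ u w u≢w → case B² u w ≟ 0F of λ where
        (yes ⊥) → inj₂ (common-orthogonal u≢w ⊥)
        (no ⊥̸)  → inj₁ (common-nonorthogonal u≢w ⊥̸)
    }

  -- Adjacency means B² = 4, so adjacent vertices are never orthogonal and always have `a` common
  -- neighbours.
  isEdgeRegular : IsEdgeRegular G
  isEdgeRegular = (_ , regular) , a , λ u w B²≡4 → common-nonorthogonal
    (λ { refl → loopless G u B²≡4 })
    (λ ⊥ → contradiction (trans (sym B²≡4) ⊥) λ ())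

  common-child-b : ∀ u w → + commonNeighbours (child G b) u w ≡ ∑[ i < v ] (rel 0F u i * rel 0F w i)
  common-child-b u w = trans (commonNeighbours-∑ (child G b) u w)
    (sum-cong-≗ λ i → cong₂ _*_ (adj-child-b u i) (adj-child-b w i))

  child-b-common : ∀ {u w} → u ≢ w → ∀ {r y} → rel 0F u w ≡ r → A + E * (+ 2 * r - 1ℤ) ≡ y →
    + commonNeighbours (child G b) u w ≡ y /ℕ 2
  child-b-common {u} {w} u≢w refl eq = halve refl
    (trans (cong (+ 2 *_) (common-child-b u w)) (trans (rel₀-pair-sum u≢w) eq))

  isStronglyRegular-b : IsStronglyRegular (child G b)
    ((+ 25 * A + + 5 * E) /ℕ 2) ((+ 5 * A - E) /ℕ 2) ((A + E) /ℕ 2) ((A - E) /ℕ 2)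
  isStronglyRegular-b = record
    { order       = order/2
    ; regular     = λ u → halve refl (trans
        (cong (+ 2 *_) (trans (degree-∑ (child G b) u) (sum-cong-≗ (adj-child-b u))))
        (rel₀-sum u))
    ; adjacent    = λ u w u~w → child-b-common (proj₁ u~w)
        (⟦⟧-true (B² u w ≟ 0F) (child-b⇒orthogonal u~w)) (plus A E)
    ; nonadjacent = λ u w u≢w u≁w → child-b-common u≢w
        (⟦⟧-false (B² u w ≟ 0F) (λ ⊥ → u≁w (orthogonal⇒child-b ⊥))) (minus A E)
    }
    where
    plus : ∀ A E → A + E * (+ 2 * 1ℤ - 1ℤ) ≡ A + E
    plus = solve-∀
    minus : ∀ A E → A + E * (+ 2 * 0ℤ - 1ℤ) ≡ A - E
    minus = solve-∀

  -- One formula, linear in r, serves both kinds of pairs: r = 0 for pairs adjacent in this child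
  -- and r = 1 for orthogonal ones.
  child-a-common : ∀ {u w} → u ≢ w → ∀ {r} → rel 0F u w ≡ r →
    + commonNeighbours (child G a) u w ≡ + 8 * A + + 3 * E - + 2 + r * (E + + 2)
  child-a-common {u} {w} u≢w {r} rel≡r = halves (begin
    + 2 * + commonNeighbours (child G a) u w
      ≡⟨ cong (+ 2 *_) (trans (commonNeighbours-∑ (child G a) u w)
           (sum-cong-≗ λ i → cong₂ _*_ (adj-child-a u i) (adj-child-a w i))) ⟩
    + 2 * ∑[ i < v ] (((1ℤ - δ u i) - rel 0F u i) * ((1ℤ - δ w i) - rel 0F w i))
      ≡⟨ cong (+ 2 *_) (∑-complement₂ u≢w (rel 0F u) (rel 0F w)) ⟩
    + 2 * (+ v - + 2 - F - F′ + rel 0F u w + rel 0F w u + H)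
      ≡⟨ cong₂ (λ x y → + 2 * (+ v - + 2 - F - F′ + x + y + H)) rel≡r
           (trans (cong (λ q → δ q 0F) (B²-sym w u)) rel≡r) ⟩
    + 2 * (+ v - + 2 - F - F′ + r + r + H)
      ≡⟨ distribute (+ v) F F′ r H ⟩
    + 2 * + v - + 4 - + 2 * F - + 2 * F′ + + 4 * r + + 2 * H
      ≡⟨ cong₂ (λ x y → x - + 4 - + 2 * F - + 2 * F′ + + 4 * r + y) order
           (trans (rel₀-pair-sum u≢w) (cong (λ r → A + E * (+ 2 * r - 1ℤ)) rel≡r)) ⟩
    + 25 * A + + 5 * E - + 4 - + 2 * F - + 2 * F′ + + 4 * r + (A + E * (+ 2 * r - 1ℤ))
      ≡⟨ cong₂ (λ x y → + 25 * A + + 5 * E - + 4 - x - y + + 4 * r + (A + E * (+ 2 * r - 1ℤ)))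
           (rel₀-sum u) (rel₀-sum w) ⟩
    + 25 * A + + 5 * E - + 4 - (+ 5 * A - E) - (+ 5 * A - E) + + 4 * r + (A + E * (+ 2 * r - 1ℤ))
      ≡⟨ collect A E r ⟩
    + 2 * (+ 8 * A + + 3 * E - + 2 + r * (E + + 2)) ∎)
    where
    F  = sum (rel 0F u)
    F′ = sum (rel 0F w)
    H  = ∑[ i < v ] (rel 0F u i * rel 0F w i)
    distribute : ∀ v F F′ r H → + 2 * (v - + 2 - F - F′ + r + r + H) ≡
      + 2 * v - + 4 - + 2 * F - + 2 * F′ + + 4 * r + + 2 * H
    distribute = solve-∀
    collect : ∀ A E r →
      + 25 * A + + 5 * E - + 4 - (+ 5 * A - E) - (+ 5 * A - E) + + 4 * r + (A + E * (+ 2 * r - 1ℤ)) ≡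
      + 2 * (+ 8 * A + + 3 * E - + 2 + r * (E + + 2))
    collect = solve-∀

  isStronglyRegular-a : IsStronglyRegular (child G a)
    ((+ 25 * A + + 5 * E) /ℕ 2) (+ 10 * A + + 3 * E - 1ℤ) (+ 8 * A + + 3 * E - + 2) (+ 8 * A + + 4 * E)
  isStronglyRegular-a = record
    { order       = order/2
    ; regular     = λ u → halves (begin
        + 2 * + degree (child G a) u
          ≡⟨ cong (+ 2 *_) (trans (degree-∑ (child G a) u) (sum-cong-≗ (adj-child-a u))) ⟩
        + 2 * ∑[ i < v ] ((1ℤ - δ u i) - rel 0F u i)
          ≡⟨ cong (+ 2 *_) (∑-complement u (rel 0F u)) ⟩
        + 2 * (+ v - 1ℤ - sum (rel 0F u))
          ≡⟨ distribute (+ v) (sum (rel 0F u)) ⟩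
        + 2 * + v - + 2 - + 2 * sum (rel 0F u)
          ≡⟨ cong₂ (λ x y → x - + 2 - y) order (rel₀-sum u) ⟩
        + 25 * A + + 5 * E - + 2 - (+ 5 * A - E)
          ≡⟨ collect A E ⟩
        + 2 * (+ 10 * A + + 3 * E - 1ℤ) ∎)
    ; adjacent    = λ u w u~w → trans
        (child-a-common (proj₁ u~w) (⟦⟧-false (B² u w ≟ 0F) (child-a⇒nonorthogonal u~w)))
        (adjacent A E)
    ; nonadjacent = λ u w u≢w u≁w → trans
        (child-a-common u≢w (case B² u w ≟ 0F of λ where
          (yes ⊥) → ⟦⟧-true (B² u w ≟ 0F) ⊥
          (no ⊥̸)  → contradiction (u≢w , common-nonorthogonal u≢w ⊥̸) u≁w))
        (nonadjacent A E)
    }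
    where
    distribute : ∀ v F → + 2 * (v - 1ℤ - F) ≡ + 2 * v - + 2 - + 2 * F
    distribute = solve-∀
    collect : ∀ A E → + 25 * A + + 5 * E - + 2 - (+ 5 * A - E) ≡ + 2 * (+ 10 * A + + 3 * E - 1ℤ)
    collect = solve-∀
    adjacent : ∀ A E → + 8 * A + + 3 * E - + 2 + 0ℤ * (E + + 2) ≡ + 8 * A + + 3 * E - + 2
    adjacent = solve-∀
    nonadjacent : ∀ A E → + 8 * A + + 3 * E - + 2 + 1ℤ * (E + + 2) ≡ + 8 * A + + 4 * E
    nonadjacent = solve-∀

-- Specialisation to powers of five

5^≢0 : ∀ k → (+ 5) ^ k ≢ 0ℤ
5^≢0 k eq with () ← ℤ.i^n≡0⇒i≡0 (+ 5) k eq

5^k*2 : ∀ k → (+ 5) ^ (k ℕ.* 2) ≡ (+ 5) ^ k * (+ 5) ^ k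
5^k*2 zero    = refl
5^k*2 (suc k) = trans (cong (λ x → + 5 * (+ 5 * x)) (5^k*2 k)) (collect ((+ 5) ^ k))
  where
  collect : ∀ K → + 5 * (+ 5 * (K * K)) ≡ + 5 * K * (+ 5 * K)
  collect = solve-∀

⌊k*2/2⌋ : ∀ k → ⌊ k ℕ.* 2 /2⌋ ≡ k
⌊k*2/2⌋ zero    = refl
⌊k*2/2⌋ (suc k) = cong suc (⌊k*2/2⌋ k)

odd⇒1+k*2 : ∀ n → parity n ≡ 1ℙ → ∃[ k ] n ≡ 1 ℕ.+ k ℕ.* 2
odd⇒1+k*2 1             _   = 0 , refl
odd⇒1+k*2 (suc (suc n)) odd with k , refl ← odd⇒1+k*2 n odd = suc k , refl

χ-surjective : ∀ ε → ε ≡ -1ℤ ⊎ ε ≡ 1ℤ → ∃[ d ] (d ≢ 0F × χ d ≡ ε)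
χ-surjective _ (inj₁ refl) = 2F , (λ ()) , refl
χ-surjective _ (inj₂ refl) = 1F , (λ ()) , refl

module _ (d : 𝔽) (d≢0 : d ≢ 0F) (k : ℕ) where

  private
    K ε : ℤ
    K = (+ 5) ^ k
    ε = χ d

  εK≢0 : ε * K ≢ 0ℤ
  εK≢0 eq with ℤ.i*j≡0⇒i≡0∨j≡0 ε eq
  ... | inj₁ ε≡0 = χ≢0 d d≢0 ε≡0
    where
    χ≢0 : ∀ d → d ≢ 0F → χ d ≢ 0ℤ
    χ≢0 0F d≢0 _ = d≢0 refl
    χ≢0 1F _ ()
    χ≢0 2F _ ()
    χ≢0 3F _ ()
    χ≢0 4F _ ()
  ... | inj₂ K≡0 = 5^≢0 k K≡0

  -- With n = 3 + 2k the powers of 5 in `#Q-formula` have exponent k + 1; pulling one factor 5 out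
  -- of each K gives the form required by `Counts`.
  #Q-formula′ : ∀ q → Form.#Q d d≢0 (3 ℕ.+ k ℕ.* 2) q ≡ + 25 * (K * K) + (+ 5 * (ε * K)) * χ q
  #Q-formula′ q = trans (Form.#Q-formula d d≢0 (suc k) q) (collect K ε (χ q))
    where
    collect : ∀ K ε c → + 5 * K * (+ 5 * K) + (ε * (+ 5 * K)) * c ≡ + 25 * (K * K) + (+ 5 * (ε * K)) * c
    collect = solve-∀

  open DezaGraph d d≢0 (3 ℕ.+ k ℕ.* 2) (K * K) (ε * K) εK≢0 #Q-formula′

  -- X stands for 5 ^ (n - 3) and L for 5 ^ ((n - 3) / 2).
  dezaGraph : ∀ X L → X ≡ K * K → L ≡ K → ∃₂ λ v G →
      IsEdgeRegular {v} G ×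
      IsDeza G ((+ 5 * (+ 5 * X) + ε * (+ 5 * L)) /ℕ 2) (+ 5 * X - ε * L)
        (+ 2 * (X - ε * L)) (+ 2 * X - ε * L) ×
      IsStronglyRegular (child G (+ 2 * (X - ε * L)))
        ((+ 5 * (+ 5 * X) + ε * (+ 5 * L)) /ℕ 2)
        ((+ 5 * X - ε * L) /ℕ 2) ((X + ε * L) /ℕ 2) ((X - ε * L) /ℕ 2) ×
      IsStronglyRegular (child G (+ 2 * X - ε * L))
        ((+ 5 * (+ 5 * X) + ε * (+ 5 * L)) /ℕ 2)
        (+ 2 * (+ 5 * X) + + 3 * ε * L - 1ℤ)
        (+ 8 * X + + 3 * ε * L - + 2)
        (+ 8 * X + + 4 * ε * L)
  dezaGraph _ _ refl refl = v , G , isEdgeRegular ,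
    subst (λ N → IsDeza G N (+ 5 * A - E) b a) N≡ isDeza ,
    subst (λ N → IsStronglyRegular (child G b) N ((+ 5 * A - E) /ℕ 2) ((A + E) /ℕ 2) ((A - E) /ℕ 2)) N≡
      isStronglyRegular-b ,
    subst₂ (λ (N , k) (l , m) → IsStronglyRegular (child G a) N k l m)
      (cong₂ _,_ N≡ (k≡ K ε)) (cong₂ _,_ (l≡ K ε) (m≡ K ε)) isStronglyRegular-a
    where
    A E : ℤ
    A = K * K
    E = ε * K
    N≡ : (+ 25 * A + + 5 * E) /ℕ 2 ≡ (+ 5 * (+ 5 * A) + ε * (+ 5 * K)) /ℕ 2
    N≡ = cong (_/ℕ 2) (collect K ε)
      where
      collect : ∀ K ε → + 25 * (K * K) + + 5 * (ε * K) ≡ + 5 * (+ 5 * (K * K)) + ε * (+ 5 * K)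
      collect = solve-∀
    k≡ : ∀ K ε → + 10 * (K * K) + + 3 * (ε * K) - 1ℤ ≡ + 2 * (+ 5 * (K * K)) + + 3 * ε * K - 1ℤ
    k≡ = solve-∀
    l≡ : ∀ K ε → + 8 * (K * K) + + 3 * (ε * K) - + 2 ≡ + 8 * (K * K) + + 3 * ε * K - + 2
    l≡ = solve-∀
    m≡ : ∀ K ε → + 8 * (K * K) + + 4 * (ε * K) ≡ + 8 * (K * K) + + 4 * ε * K
    m≡ = solve-∀

mainTheorem1 :
  (n : ℕ) → 3 < n → parity n ≡ 1ℙ →
  (ε : ℤ) → ε ≡ -1ℤ ⊎ ε ≡ 1ℤ →
  let N = ((+ 5) ^ (n ∸ 1) + ε * (+ 5) ^ ⌊ n ∸ 1 /2⌋) /ℕ 2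
      b = + 2 * ((+ 5) ^ (n ∸ 3) - ε * (+ 5) ^ ⌊ n ∸ 3 /2⌋)
      a = + 2 * (+ 5) ^ (n ∸ 3) - ε * (+ 5) ^ ⌊ n ∸ 3 /2⌋
  in
  ∃[ v ] ∃[ G ]
    IsEdgeRegular {v} G ×
    IsDeza G N ((+ 5) ^ (n ∸ 2) - ε * (+ 5) ^ ⌊ n ∸ 3 /2⌋) b a ×
    IsStronglyRegular (child G b)
      N
      (((+ 5) ^ (n ∸ 2) - ε * (+ 5) ^ ⌊ n ∸ 3 /2⌋) /ℕ 2)
      (((+ 5) ^ (n ∸ 3) + ε * (+ 5) ^ ⌊ n ∸ 3 /2⌋) /ℕ 2)
      (((+ 5) ^ (n ∸ 3) - ε * (+ 5) ^ ⌊ n ∸ 3 /2⌋) /ℕ 2) ×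
    IsStronglyRegular (child G a)
      N
      (+ 2 * (+ 5) ^ (n ∸ 2) + + 3 * ε * (+ 5) ^ ⌊ n ∸ 3 /2⌋ - 1ℤ)
      (+ 8 * (+ 5) ^ (n ∸ 3) + + 3 * ε * (+ 5) ^ ⌊ n ∸ 3 /2⌋ - + 2)
      (+ 8 * (+ 5) ^ (n ∸ 3) + + 4 * ε * (+ 5) ^ ⌊ n ∸ 3 /2⌋)
mainTheorem1 n 3<n odd ε ε≡±1 with odd⇒1+k*2 n odd | χ-surjective ε ε≡±1
-- This case is n = 1, excluded by 3 < n.
mainTheorem1 _ (s≤s ()) _ _ _ | zero , refl | _
-- Now n = 3 + 2k, so all truncated subtractions compute and only 5^(2k) and the half of 2k remain
-- to be rewritten.
mainTheorem1 _ _ _ _ _ | suc k , refl | d , d≢0 , refl =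
  dezaGraph d d≢0 k ((+ 5) ^ (k ℕ.* 2)) ((+ 5) ^ ⌊ k ℕ.* 2 /2⌋) (5^k*2 k) (cong ((+ 5) ^_) (⌊k*2/2⌋ k))
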